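{- For all positive integers $n$ and $a$, and every positive integer $b$, we have $\chi_\ell(K_n \square K_{a,b}) = n+a$ if and only if $b \geq \left(\frac{(n+a-1)!}{(a-1)!}\right)^a$. Equivalently, $f_a(K_n) = \left(\frac{(n+a-1)!}{(a-1)!}\right)^a$ for all $n,a \in \mathbb{N}$.
   Context: $K_n$ is the complete graph on $n$ vertices and $K_{a,b}$ is the complete bipartite graph with partite sets of sizes $a$ and $b$. The Cartesian product $G \square H$ has vertex set $V(G)\times V(H)$, with $(u,v)$ adjacent to $(u',v')$ iff either $u=u'$ and $vv'\in E(H)$, or $v=v'$ and $uu'\in E(G)$. A $k$-assignment $L$ for a graph $G$ assigns to each vertex $v$ a list $L(v)$ of $k$ colors; $G$ is $L$-colorable if it has a proper coloring $f$ with $f(v)\in L(v)$ for all $v$. The list chromatic number $\chi_\ell(G)$ is the least $k$ such that $G$ is $L$-colorable for every $k$-assignment $L$. For a graph $G$ and $a\in\mathbb{N}$, $f_a(G)$ denotes the smallest positive integer $b$ such that $\chi_\ell(G\square K_{a,b}) = \chi_\ell(G)+a$. -}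

module Defs where

open import Level using (0ℓ)
open import Data.Nat using (ℕ; _+_; _∸_; _!; _/_; _≤_)
open import Data.Nat.Properties using (_!≢0)
open import Data.Fin using (Fin)
open import Data.Sum using (_⊎_; inj₁; inj₂)
open import Data.Product using (_×_; Σ; ∃)
open import Data.Unit using (⊤)
open import Data.Empty using (⊥)
open import Data.List using (List; length)
open import Data.List.Membership.Propositional using (_∈_)
open import Data.List.Relation.Unary.Unique.Propositional using (Unique)
open import Relation.Binary.PropositionalEquality using (_≡_; _≢_)

record Graph : Set₁ where
  field
    V   : Set
    Adj : V → V → Set
open Graph public

K : ℕ → Graph
K n = record { V = Fin n ; Adj = λ u v → u ≢ v }

KBip-adj : {a b : ℕ} → Fin a ⊎ Fin b → Fin a ⊎ Fin b → Set
KBip-adj (inj₁ _) (inj₁ _) = ⊥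
KBip-adj (inj₁ _) (inj₂ _) = ⊤
KBip-adj (inj₂ _) (inj₁ _) = ⊤
KBip-adj (inj₂ _) (inj₂ _) = ⊥

KBip : ℕ → ℕ → Graph
KBip a b = record { V = Fin a ⊎ Fin b ; Adj = KBip-adj }

_□_ : Graph → Graph → Graph
G □ H = record
  { V   = V G × V H
  ; Adj = λ p q → (Data.Product.proj₁ p ≡ Data.Product.proj₁ q × Adj H (Data.Product.proj₂ p) (Data.Product.proj₂ q))
                ⊎ (Data.Product.proj₂ p ≡ Data.Product.proj₂ q × Adj G (Data.Product.proj₁ p) (Data.Product.proj₁ q))
  }

IsAssignment : (G : Graph) → ℕ → (V G → List ℕ) → Set
IsAssignment G k L = (v : V G) → (length (L v) ≡ k) × Unique (L v)

LColorable : (G : Graph) → (V G → List ℕ) → Set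
LColorable G L = Σ (V G → ℕ) λ f →
  ((v : V G) → f v ∈ L v) × ((u v : V G) → Adj G u v → f u ≢ f v)

Choosable : Graph → ℕ → Set
Choosable G k = (L : V G → List ℕ) → IsAssignment G k L → LColorable G L

ListChromaticNumber : Graph → ℕ → Set
ListChromaticNumber G m = Choosable G m × ((k : ℕ) → Choosable G k → m ≤ k)

ratio : ℕ → ℕ → ℕ
ratio n a = ((n + a ∸ 1) !) / ((a ∸ 1) !)
  where instance _ = (a ∸ 1) !≢0

{-# OPTIONS --safe #-}

-- Write n = m + 1 and k = m + a. Colouring the a left copies of K_n greedily always leaves lists of
-- size n on the right, so (n + a)-assignments are harmless. If there are at least
-- (k (k − 1) ⋯ a) ^ a right copies, give the left copies disjoint k-sets of colours and let each
-- right copy defeat one left colouring: its lists consist of the colours of that colouring and m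
-- reserve colours.
--
-- Conversely, let a k-assignment with fewer right copies be given. If two left lists at one vertex
-- of K_n meet, using a common colour on both leaves a colourable residue everywhere. Otherwise, by
-- Hall's theorem, a right copy S defeats a left colouring c only if the sets S v \ c(v, ·) are m-sets
-- independent of v. A copy may defeat several colourings, which must then repeat colours of row 0 in
-- all other rows, so give c the weight 2 ^ -#{(v, i) : v ≥ 1, c(v, i) occurs in row 0}. A copy defeats
-- at most 2 ^ m colourings, and if it defeats more than one then each has weight at most 2 ^ -m, so it
-- defeats total weight at most 1. Building the colourings row by row, a colour of row 0 available at
-- another index costs half a choice there but saves a choice at its own index; hence the total weight
-- is at least (k (k − 1) ⋯ a) ^ a, and some colouring survives. Weights are scaled by (2 ^ a) ^ m below.

module Submission where

open import Defs
open import Data.Nat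
open import Data.Nat.DivMod using (m*n/n≡m)
open import Data.Nat.ListAction using (sum; product)
open import Data.Nat.Properties
open import Data.Nat.Tactic.RingSolver using (solve-∀)
open import Data.Fin using (Fin; zero; suc; toℕ; fromℕ<; inject≤; combine; punchIn; punchOut; _↑ˡ_)
import Data.Fin.Properties as Fin
open import Data.List
  using (List; []; _∷_; _++_; [_]; length; map; filter; concatMap; tabulate; allFin; take)
import Data.List as List
open import Data.List.Membership.Propositional using (_∈_; _∉_; find; lose)
open import Data.List.Membership.Propositional.Properties
open import Data.List.Membership.DecPropositional _≟_ using (_∈?_; _∉?_)
open import Data.List.Properties
  using (length-++; length-++-sucʳ; length-tabulate; length-take; length-filter; filter-notAll)
open import Data.List.Relation.Binary.Subset.Propositional using (_⊆_)
open import Data.List.Relation.Unary.All as All using (All; []; _∷_)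
open import Data.List.Relation.Unary.All.Properties using (¬Any⇒All¬; All¬⇒¬Any)
open import Data.List.Relation.Unary.AllPairs using ([]; _∷_)
open import Data.List.Relation.Unary.Any as Any using (here; there)
open import Data.List.Relation.Unary.Any.Properties using (lookup-index)
open import Data.List.Relation.Unary.Unique.Propositional using (Unique)
import Data.List.Relation.Unary.Unique.Propositional.Properties as Unique
open import Data.Product using (_×_; _,_; proj₁; proj₂; Σ; ∃)
open import Data.Sum using (inj₁; inj₂)
open import Data.Unit using (tt)
open import Data.Vec using (Vec; []; _∷_; head; lookup)
import Data.Vec as Vec
open import Data.Vec.Functional using (insertAt)
open import Data.Vec.Functional.Properties using (insertAt-lookup; insertAt-punchIn)
import Data.Vec.Properties as Vec
open import Function using (_∘_; id)
open import Relation.Binary.PropositionalEquality hiding ([_])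
open import Relation.Nullary using (Dec; yes; no; ¬_; contradiction)
open import Relation.Nullary.Decidable using (_×-dec_; ¬?; decidable-stable)
open import Relation.Unary using (Decidable)

private variable
  X Y : Set
  a m n : ℕ

-- Duplicate-free lists and list difference

∉⇒unique-∷ : {x : X} {xs : List X} → x ∉ xs → Unique xs → Unique (x ∷ xs)
∉⇒unique-∷ x∉xs u = ¬Any⇒All¬ _ x∉xs ∷ u

unique-head∉ : {x : X} {xs : List X} → Unique (x ∷ xs) → x ∉ xs
unique-head∉ (px ∷ _) = All¬⇒¬Any px

injection⇒length≤ : {xs : List X} {ys : List Y} (f : X → Y) → Unique xs →
  (∀ {x x′} → x ∈ xs → x′ ∈ xs → f x ≡ f x′ → x ≡ x′) →
  (∀ {x} → x ∈ xs → f x ∈ ys) → length xs ≤ length ys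
injection⇒length≤ {xs = []} f u inj into = z≤n
injection⇒length≤ {xs = x ∷ xs} {ys} f u@(_ ∷ u′) inj into
  with us , vs , refl ← ∈-∃++ (into (here refl)) = begin
    suc (length xs)         ≤⟨ s≤s (injection⇒length≤ f u′ (λ p q → inj (there p) (there q)) into′) ⟩
    suc (length (us ++ vs)) ≡⟨ length-++-sucʳ us (f x) vs ⟨
    length (us ++ f x ∷ vs) ∎
  where
  open ≤-Reasoning
  into′ : ∀ {y} → y ∈ xs → f y ∈ us ++ vs
  into′ {y} y∈ with ∈-++⁻ us (into (there y∈))
  ... | inj₁ p = ∈-++⁺ˡ p
  ... | inj₂ (there p) = ∈-++⁺ʳ us p
  ... | inj₂ (here eq) =
    contradiction (subst (_∈ xs) (inj (there y∈) (here refl) eq) y∈) (unique-head∉ u)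

⊆⇒length≤ : {xs ys : List X} → Unique xs → xs ⊆ ys → length xs ≤ length ys
⊆⇒length≤ u = injection⇒length≤ id u (λ _ _ eq → eq)

length>0⇒∃ : {xs : List X} → 1 ≤ length xs → ∃ (_∈ xs)
length>0⇒∃ {xs = x ∷ _} _ = x , here refl

infixl 6 _∖_
_∖_ : List ℕ → List ℕ → List ℕ
xs ∖ ys = filter (_∉? ys) xs

∖-unique : ∀ {xs} ys → Unique xs → Unique (xs ∖ ys)
∖-unique ys = Unique.filter⁺ (_∉? ys)

∈-∖⁺ : ∀ {x xs ys} → x ∈ xs → x ∉ ys → x ∈ xs ∖ ys
∈-∖⁺ {ys = ys} = ∈-filter⁺ (_∉? ys)

∈-∖⁻ : ∀ {x xs} ys → x ∈ xs ∖ ys → x ∈ xs × x ∉ ys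
∈-∖⁻ ys = ∈-filter⁻ (_∉? ys)

⊆∖++ : ∀ {zs} xs ys → ys ⊆ zs → xs ⊆ (xs ∖ ys) ++ zs
⊆∖++ xs ys ys⊆zs {x} x∈ with x ∈? ys
... | yes x∈ys = ∈-++⁺ʳ (xs ∖ ys) (ys⊆zs x∈ys)
... | no  x∉ys = ∈-++⁺ˡ (∈-∖⁺ x∈ x∉ys)

length-∖-⊆ : ∀ {xs} ys zs → Unique xs → ys ⊆ zs → length xs ≤ length (xs ∖ ys) + length zs
length-∖-⊆ {xs} ys zs u ys⊆zs =
  subst (length xs ≤_) (length-++ (xs ∖ ys)) (⊆⇒length≤ u (⊆∖++ xs ys ys⊆zs))

length-∖ : ∀ {xs} ys → Unique xs → length xs ≤ length (xs ∖ ys) + length ys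
length-∖ ys u = length-∖-⊆ ys ys u id

-- Striking `y` costs `xs` nothing: the list `y ∷ xs` is still duplicate-free and is covered by the
-- remainder together with `ys`.
length-∖-< : ∀ {xs ys y} → Unique xs → y ∈ ys → y ∉ xs →
  length xs < length (xs ∖ ys) + length ys
length-∖-< {xs} {ys} {y} u y∈ys y∉xs =
  subst (length xs <_) (length-++ (xs ∖ ys)) (⊆⇒length≤ (∉⇒unique-∷ y∉xs u) sub)
  where
  sub : y ∷ xs ⊆ (xs ∖ ys) ++ ys
  sub (here refl) = ∈-++⁺ʳ (xs ∖ ys) y∈ys
  sub (there p)   = ⊆∖++ xs ys id p

-- Position `i` of `f` is redundant, so at most `a` different colours are struck.
length-∖-repeat : ∀ {xs} (f : Fin (suc a) → ℕ) {i j} → i ≢ j → f i ≡ f j → Unique xs →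
  length xs ≤ length (xs ∖ tabulate f) + a
length-∖-repeat {a} {xs} f {i} {j} i≢j fi≡fj u =
  subst (λ l → length xs ≤ length (xs ∖ tabulate f) + l) (length-tabulate (f ∘ punchIn i))
    (length-∖-⊆ (tabulate f) (tabulate (f ∘ punchIn i)) u sub)
  where
  others : ∀ l → i ≢ l → f l ∈ tabulate (f ∘ punchIn i)
  others l i≢l = subst (λ z → f z ∈ tabulate (f ∘ punchIn i)) (Fin.punchIn-punchOut i≢l)
                   (∈-tabulate⁺ (punchOut i≢l))
  sub : tabulate f ⊆ tabulate (f ∘ punchIn i)
  sub p with ∈-tabulate⁻ {f = f} p
  ... | l , refl with i Fin.≟ l
  ... | no i≢l = others l i≢l
  ... | yes refl = subst (_∈ tabulate (f ∘ punchIn i)) (sym fi≡fj) (others j i≢j)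

-- Systems of distinct representatives

SDR : (Fin n → List ℕ) → Set
SDR {n} R = Σ (Fin n → ℕ) λ f → (∀ v → f v ∈ R v) × (∀ u v → u ≢ v → f u ≢ f v)

insert-SDR : (R : Fin (suc n) → List ℕ) (w : Fin (suc n)) {y : ℕ} → y ∈ R w →
  ((f , _) : SDR (R ∘ punchIn w)) → (∀ v → f v ≢ y) →
  Σ (SDR R) λ (g , _) → g w ≡ y
insert-SDR R w {y} y∈ (f , f∈ , inj) fresh = (g , g∈ , g-inj) , g-w
  where
  g = insertAt f w y
  g-w : g w ≡ y
  g-w = insertAt-lookup f w y
  g-in : ∀ {v} (w≢v : w ≢ v) → g v ≡ f (punchOut w≢v)
  g-in w≢v = trans (cong g (sym (Fin.punchIn-punchOut w≢v))) (insertAt-punchIn f w y _)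
  g∈ : ∀ v → g v ∈ R v
  g∈ v with w Fin.≟ v
  ... | yes refl = subst (_∈ R w) (sym g-w) y∈
  ... | no w≢v = subst₂ (λ x z → x ∈ R z) (sym (g-in w≢v)) (Fin.punchIn-punchOut w≢v) (f∈ _)
  g-inj : ∀ u v → u ≢ v → g u ≢ g v
  g-inj u v u≢v eq with w Fin.≟ u | w Fin.≟ v
  ... | yes refl | yes refl = u≢v refl
  ... | yes refl | no w≢v = fresh _ (trans (sym (g-in w≢v)) (trans (sym eq) g-w))
  ... | no w≢u | yes refl = fresh _ (trans (sym (g-in w≢u)) (trans eq g-w))
  ... | no w≢u | no w≢v = inj _ _ (u≢v ∘ Fin.punchOut-injective w≢u w≢v)
                            (trans (sym (g-in w≢u)) (trans eq (g-in w≢v)))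

extend-SDR : (R : Fin (suc n) → List ℕ) (w : Fin (suc n)) {y : ℕ} → y ∈ R w →
  SDR (λ v → R (punchIn w v) ∖ [ y ]) → Σ (SDR R) λ (g , _) → g w ≡ y
extend-SDR R w {y} y∈ (f , f∈ , inj) =
  insert-SDR R w y∈ (f , (λ v → proj₁ (split v)) , inj) λ v eq → proj₂ (split v) (here eq)
  where
  split : ∀ v → f v ∈ R (punchIn w v) × f v ∉ [ y ]
  split v = ∈-∖⁻ {xs = R (punchIn w v)} [ y ] (f∈ v)

length-∖-[] : ∀ {xs k} y → Unique xs → suc k ≤ length xs → k ≤ length (xs ∖ [ y ])
length-∖-[] {xs} {k} y u le =
  +-cancelʳ-≤ 1 _ _ (≤-trans (≤-reflexive (+-comm k 1)) (≤-trans le (length-∖ [ y ] u)))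

greedy : (R : Fin n → List ℕ) → (∀ v → Unique (R v)) → (∀ v → n ≤ length (R v)) → SDR R
greedy {zero} R u len = (λ ()) , (λ ()) , λ ()
greedy {suc n} R u len with length>0⇒∃ (≤-trans (s≤s z≤n) (len zero))
... | y , y∈ = proj₁ (extend-SDR R zero y∈ (greedy _ (λ v → ∖-unique [ y ] (u (suc v)))
                 (λ v → length-∖-[] y (u (suc v)) (len (suc v)))))

greedy-prescribed : (R : Fin (suc n) → List ℕ) → (∀ v → Unique (R v)) →
  (∀ v → suc n ≤ length (R v)) → ∀ w {y} → y ∈ R w → Σ (SDR R) λ (f , _) → f w ≡ y
greedy-prescribed R u len w {y} y∈ =
  extend-SDR R w y∈ (greedy _ (λ v → ∖-unique [ y ] (u _)) (λ v → length-∖-[] y (u _) (len _)))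

-- The vertex `w` is served last: the other `n` vertices use at most `n` colours, fewer than `R w`
-- offers.
greedy-one-long : (R : Fin (suc n) → List ℕ) → (∀ v → Unique (R v)) →
  (∀ v → n ≤ length (R v)) → ∀ w → n < length (R w) → SDR R
greedy-one-long {n} R u len w long = proj₁ (insert-SDR R w (proj₁ y-free) rest fresh)
  where
  rest : SDR (R ∘ punchIn w)
  rest = greedy _ (λ v → u _) (λ v → len _)
  used = tabulate (proj₁ rest)
  free : ∃ (_∈ R w ∖ used)
  free = length>0⇒∃ (+-cancelʳ-≤ n _ _
    (≤-trans long (subst (λ l → _ ≤ length (R w ∖ used) + l) (length-tabulate (proj₁ rest)) (length-∖ used (u w)))))
  y-free = ∈-∖⁻ used (proj₂ free)
  fresh : ∀ v → proj₁ rest v ≢ proj₁ free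
  fresh v eq = proj₂ y-free (subst (_∈ used) eq (∈-tabulate⁺ v))

-- Give `w` the colour `y`. This takes nothing from `R zero`, which thereby becomes the long list
-- that `greedy-one-long` needs for the remaining vertices.
greedy-two-distinct : (R : Fin (suc n) → List ℕ) → (∀ v → Unique (R v)) →
  (∀ v → n ≤ length (R v)) → ∀ w {y} → y ∈ R w → y ∉ R zero → SDR R
greedy-two-distinct R u len zero y∈ y∉ = contradiction y∈ y∉
greedy-two-distinct {suc n} R u len (suc w) {y} y∈ y∉ =
  proj₁ (extend-SDR R (suc w) y∈
    (greedy-one-long _ (λ v → ∖-unique [ y ] (u _)) (λ v → length-∖-[] y (u _) (len _)) zero
      (+-cancelʳ-≤ 1 _ _ (≤-trans (≤-reflexive (+-comm (suc n) 1))
        (≤-trans (s≤s (len zero)) (length-∖-< (u zero) (here refl) y∉))))))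

-- By Hall's theorem, lists of length at least n on n + 1 vertices have no SDR
-- only if they are n + 1 copies of the same n-set.
Obstruction : (Fin (suc n) → List ℕ) → Set
Obstruction {n} R = (∀ v → length (R v) ≤ n) × (∀ v → All (_∈ R zero) (R v))

obstruction? : (R : Fin (suc n) → List ℕ) → Dec (Obstruction R)
obstruction? {n} R =
  Fin.all? (λ v → length (R v) ≤? n) ×-dec Fin.all? (λ v → All.all? (_∈? R zero) (R v))

-- If no list is longer than `n`, the failure of `Obstruction` yields a colour outside `R zero`;
-- these are the two greedy cases above.
unobstructed⇒SDR : (R : Fin (suc n) → List ℕ) → (∀ v → Unique (R v)) →
  (∀ v → n ≤ length (R v)) → ¬ Obstruction R → SDR R
unobstructed⇒SDR {n} R u len ¬obs with Fin.any? (λ v → n <? length (R v))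
... | yes (w , long) = greedy-one-long R u len w long
... | no ¬long with Fin.any? (λ v → Any.any? (_∉? R zero) (R v))
... | yes (w , some) with y , y∈ , y∉ ← find some = greedy-two-distinct R u len w y∈ y∉
... | no ¬some = contradiction
  ((λ v → ≮⇒≥ (λ l → ¬long (v , l))) ,
   (λ v → All.map (λ {x} → decidable-stable (x ∈? R zero)) (¬Any⇒All¬ (R v) (λ s → ¬some (v , s)))))
  ¬obs

-- Finite sums and products

∑ : (X → ℕ) → List X → ℕ
∑ f xs = sum (map f xs)

∑-++ : (f : X → ℕ) (xs ys : List X) → ∑ f (xs ++ ys) ≡ ∑ f xs + ∑ f ys
∑-++ f [] ys = refl
∑-++ f (x ∷ xs) ys = trans (cong (f x +_) (∑-++ f xs ys)) (sym (+-assoc (f x) _ _))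

∑-cong : {f g : X → ℕ} (xs : List X) → (∀ x → f x ≡ g x) → ∑ f xs ≡ ∑ g xs
∑-cong [] eq = refl
∑-cong (x ∷ xs) eq = cong₂ _+_ (eq x) (∑-cong xs eq)

∑-mono : {f g : X → ℕ} (xs : List X) → (∀ x → f x ≤ g x) → ∑ f xs ≤ ∑ g xs
∑-mono [] le = z≤n
∑-mono (x ∷ xs) le = +-mono-≤ (le x) (∑-mono xs le)

∑-map : (f : Y → ℕ) (g : X → Y) (xs : List X) → ∑ f (map g xs) ≡ ∑ (f ∘ g) xs
∑-map f g [] = refl
∑-map f g (x ∷ xs) = cong (f (g x) +_) (∑-map f g xs)

∑-*ˡ : (c : ℕ) (f : X → ℕ) (xs : List X) → ∑ (λ x → c * f x) xs ≡ c * ∑ f xs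
∑-*ˡ c f [] = sym (*-zeroʳ c)
∑-*ˡ c f (x ∷ xs) = trans (cong (c * f x +_) (∑-*ˡ c f xs)) (sym (*-distribˡ-+ c (f x) _))

∑-*ʳ : (c : ℕ) (f : X → ℕ) (xs : List X) → ∑ (λ x → f x * c) xs ≡ ∑ f xs * c
∑-*ʳ c f [] = refl
∑-*ʳ c f (x ∷ xs) = trans (cong (f x * c +_) (∑-*ʳ c f xs)) (sym (*-distribʳ-+ c (f x) _))

length≡∑ : (xs : List X) → length xs ≡ ∑ (λ _ → 1) xs
length≡∑ [] = refl
length≡∑ (x ∷ xs) = cong suc (length≡∑ xs)

∏ : (Fin a → ℕ) → ℕ
∏ f = product (tabulate f)

∏-mono : {f g : Fin a → ℕ} → (∀ i → f i ≤ g i) → ∏ f ≤ ∏ g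
∏-mono {zero} le = ≤-refl
∏-mono {suc a} le = *-mono-≤ (le zero) (∏-mono (le ∘ suc))

sum-tabulate-mono : {f g : Fin a → ℕ} → (∀ i → f i ≤ g i) → sum (tabulate f) ≤ sum (tabulate g)
sum-tabulate-mono {zero} le = z≤n
sum-tabulate-mono {suc a} le = +-mono-≤ (le zero) (sum-tabulate-mono (le ∘ suc))

∏-const : (c : ℕ) → ∏ {a} (λ _ → c) ≡ c ^ a
∏-const {zero} c = refl
∏-const {suc a} c = cong (c *_) (∏-const {a} c)

*-interchange : ∀ s t u v → s * t * (u * v) ≡ s * u * (t * v)
*-interchange = solve-∀

^-distribʳ-* : ∀ x y e → (x * y) ^ e ≡ x ^ e * y ^ e
^-distribʳ-* x y zero = refl
^-distribʳ-* x y (suc e) =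
  trans (cong (x * y *_) (^-distribʳ-* x y e)) (*-interchange x y (x ^ e) (y ^ e))

-- Enumerations of vectors

branch : List X → (X → List (Vec X n)) → List (Vec X (suc n))
branch xs f = concatMap (λ x → map (x ∷_) (f x)) xs

∑-branch : (F : Vec X (suc n) → ℕ) (xs : List X) (f : X → List (Vec X n)) →
  ∑ F (branch xs f) ≡ ∑ (λ x → ∑ (λ v → F (x ∷ v)) (f x)) xs
∑-branch F [] f = refl
∑-branch F (x ∷ xs) f = trans (∑-++ F (map (x ∷_) (f x)) _)
  (cong₂ _+_ (∑-map F (x ∷_) (f x)) (∑-branch F xs f))

∈-branch⁺ : {xs : List X} {f : X → List (Vec X n)} {x : X} {v : Vec X n} →
  x ∈ xs → v ∈ f x → x ∷ v ∈ branch xs f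
∈-branch⁺ {x = x} (here refl) v∈ = ∈-++⁺ˡ (∈-map⁺ (x ∷_) v∈)
∈-branch⁺ {xs = y ∷ _} {f} (there x∈) v∈ = ∈-++⁺ʳ (map (y ∷_) (f y)) (∈-branch⁺ x∈ v∈)

∈-branch⁻ : (xs : List X) {f : X → List (Vec X n)} {x : X} {v : Vec X n} →
  x ∷ v ∈ branch xs f → x ∈ xs × v ∈ f x
∈-branch⁻ (y ∷ ys) {f} p with ∈-++⁻ (map (y ∷_) (f y)) p
... | inj₂ q = let x∈ , v∈ = ∈-branch⁻ ys q in there x∈ , v∈
... | inj₁ q with ∈-map⁻ (y ∷_) q
... | _ , v∈ , refl = here refl , v∈

branch-unique : {xs : List X} {f : X → List (Vec X n)} →
  Unique xs → (∀ x → Unique (f x)) → Unique (branch xs f)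
branch-unique [] uf = []
branch-unique {xs = x ∷ xs} {f} u@(_ ∷ u′) uf =
  Unique.++⁺ (Unique.map⁺ (λ { refl → refl }) (uf x)) (branch-unique u′ uf) disj
  where
  disj : ∀ {v} → ¬ (v ∈ map (x ∷_) (f x) × v ∈ branch xs f)
  disj (p , q) with ∈-map⁻ (x ∷_) p
  ... | _ , _ , refl = unique-head∉ u (proj₁ (∈-branch⁻ xs q))

choices : (Fin a → List X) → List (Vec X a)
choices {zero} B = [ [] ]
choices {suc a} B = branch (B zero) (λ _ → choices (B ∘ suc))

∈-choices⁺ : (B : Fin a → List X) {r : Vec X a} → (∀ i → lookup r i ∈ B i) → r ∈ choices B
∈-choices⁺ B {[]} r∈ = here refl
∈-choices⁺ B {x ∷ r} r∈ = ∈-branch⁺ (r∈ zero) (∈-choices⁺ (B ∘ suc) (r∈ ∘ suc))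

∈-choices⁻ : (B : Fin a → List X) {r : Vec X a} → r ∈ choices B → ∀ i → lookup r i ∈ B i
∈-choices⁻ B {x ∷ r} p zero = proj₁ (∈-branch⁻ (B zero) p)
∈-choices⁻ B {x ∷ r} p (suc i) = ∈-choices⁻ (B ∘ suc) (proj₂ (∈-branch⁻ (B zero) p)) i

choices-unique : {B : Fin a → List X} → (∀ i → Unique (B i)) → Unique (choices B)
choices-unique {zero} u = [] ∷ []
choices-unique {suc a} u = branch-unique (u zero) (λ _ → choices-unique (u ∘ suc))

weigh : (X → ℕ) → Vec X n → ℕ
weigh f [] = 1
weigh f (x ∷ v) = f x * weigh f v

-- Distributive law: expanding the product of the sums gives one summand per choice.
∑-choices : (f : X → ℕ) (B : Fin a → List X) → ∑ (weigh f) (choices B) ≡ ∏ (∑ f ∘ B)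
∑-choices {a = zero} f B = refl
∑-choices {a = suc a} f B = begin
  ∑ (weigh f) (choices B)
    ≡⟨ ∑-branch (weigh f) (B zero) _ ⟩
  ∑ (λ x → ∑ (λ r → f x * weigh f r) rest) (B zero)
    ≡⟨ ∑-cong (B zero) (λ x → trans (∑-*ˡ (f x) (weigh f) rest) (cong (f x *_) (∑-choices f (B ∘ suc)))) ⟩
  ∑ (λ x → f x * ∏ (∑ f ∘ B ∘ suc)) (B zero)
    ≡⟨ ∑-*ʳ _ f (B zero) ⟩
  ∏ (∑ f ∘ B) ∎
  where
  open ≡-Reasoning
  rest = choices (B ∘ suc)

length-choices : (B : Fin a → List X) → length (choices B) ≡ ∏ (length ∘ B)
length-choices {zero} B = refl
length-choices {suc a} B = begin
  length (choices B)                     ≡⟨ length≡∑ (choices B) ⟩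
  ∑ (λ _ → 1) (choices B)                ≡⟨ ∑-branch (λ _ → 1) (B zero) _ ⟩
  ∑ (λ _ → ∑ (λ _ → 1) rest) (B zero)
    ≡⟨ ∑-cong (B zero) (λ _ → trans (sym (length≡∑ rest)) (sym (*-identityˡ _))) ⟩
  ∑ (λ _ → 1 * length rest) (B zero)     ≡⟨ ∑-*ʳ (length rest) (λ _ → 1) (B zero) ⟩
  ∑ (λ _ → 1) (B zero) * length rest     ≡⟨ cong₂ _*_ (sym (length≡∑ (B zero))) (length-choices (B ∘ suc)) ⟩
  ∏ (length ∘ B) ∎
  where
  open ≡-Reasoning
  rest = choices (B ∘ suc)

-- Counting with disjoint lists

Disjointed : (Fin a → List ℕ) → Set
Disjointed A = ∀ {i j x} → x ∈ A i → x ∈ A j → i ≡ j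

module _ {P Q : X → Set} (P? : Decidable P) (Q? : Decidable Q) where

  length-filter-filter : (∀ {x} → P x → Q x) → ∀ xs →
    length (filter P? xs) ≤ length (filter P? (filter Q? xs))
  length-filter-filter P⇒Q [] = z≤n
  length-filter-filter P⇒Q (x ∷ xs) with Q? x
  ... | no ¬q with P? x
  ...   | yes p = contradiction (P⇒Q p) ¬q
  ...   | no _ = length-filter-filter P⇒Q xs
  length-filter-filter P⇒Q (x ∷ xs) | yes q with P? x
  ...   | yes p = s≤s (length-filter-filter P⇒Q xs)
  ...   | no _ = length-filter-filter P⇒Q xs

length-filter-∈-∉ : (ys xs : List ℕ) →
  length (filter (_∈? ys) xs) + length (xs ∖ ys) ≡ length xs
length-filter-∈-∉ ys [] = refl
length-filter-∈-∉ ys (x ∷ xs) with x ∈? ys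
... | yes _ = cong suc (length-filter-∈-∉ ys xs)
... | no _ = trans (+-suc _ _) (cong suc (length-filter-∈-∉ ys xs))

-- Entries in `A zero` lie in no other list, so they can be set aside before the other lists are
-- counted. Repeated entries of `xs` count with multiplicity.
disjointed-count : (A : Fin a → List ℕ) → Disjointed A → ∀ xs →
  sum (tabulate (λ i → length (filter (_∈? A i) xs))) ≤ length xs
disjointed-count {zero} A disj xs = z≤n
disjointed-count {suc a} A disj xs = begin
  length (filter (_∈? A zero) xs) + sum (tabulate (λ i → length (filter (_∈? A (suc i)) xs)))
    ≤⟨ +-monoʳ-≤ (length (filter (_∈? A zero) xs)) (sum-tabulate-mono λ i → length-filter-filter (_∈? A (suc i)) (_∉? A zero)
         (λ p q → contradiction (disj q p) λ ()) xs) ⟩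
  length (filter (_∈? A zero) xs) + sum (tabulate (λ i → length (filter (_∈? A (suc i)) (xs ∖ A zero))))
    ≤⟨ +-monoʳ-≤ (length (filter (_∈? A zero) xs)) (disjointed-count (A ∘ suc) (λ p q → Fin.suc-injective (disj p q)) (xs ∖ A zero)) ⟩
  length (filter (_∈? A zero) xs) + length (xs ∖ A zero)
    ≡⟨ length-filter-∈-∉ (A zero) xs ⟩
  length xs ∎
  where open ≤-Reasoning

2*m≤2^m : ∀ p → 2 * p ≤ 2 ^ p
2*m≤2^m zero = z≤n
2*m≤2^m (suc zero) = ≤-refl
2*m≤2^m (suc (suc p)) = begin
  2 * suc (suc p)         ≡⟨ *-distribˡ-+ 2 1 (suc p) ⟩
  2 + 2 * suc p           ≤⟨ +-mono-≤ {2} {2 ^ suc p} (*-monoʳ-≤ 2 (m^n>0 2 p)) (2*m≤2^m (suc p)) ⟩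
  2 ^ suc p + 2 ^ suc p   ≡⟨ cong (2 ^ suc p +_) (sym (+-identityʳ _)) ⟩
  2 ^ suc (suc p)         ∎
  where open ≤-Reasoning

2^*∏≤2^sum : (p : Fin a → ℕ) → 2 ^ a * ∏ p ≤ 2 ^ sum (tabulate p)
2^*∏≤2^sum {zero} p = ≤-refl
2^*∏≤2^sum {suc a} p = begin
  2 * 2 ^ a * (p zero * ∏ (p ∘ suc))       ≡⟨ *-interchange 2 (2 ^ a) (p zero) _ ⟩
  2 * p zero * (2 ^ a * ∏ (p ∘ suc))       ≤⟨ *-mono-≤ (2*m≤2^m (p zero)) (2^*∏≤2^sum (p ∘ suc)) ⟩
  2 ^ p zero * 2 ^ sum (tabulate (p ∘ suc)) ≡⟨ ^-distribˡ-+-* 2 (p zero) _ ⟨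
  2 ^ sum (tabulate p) ∎
  where
  open ≤-Reasoning

-- Let p i be the number of entries of `xs` in `A i`. Since 2 p ≤ 2 ^ p, the product of the 2 p i is
-- at most 2 to the sum of the p i, hence at most 2 ^ (m + a). This later bounds the number of
-- colourings that one right copy defeats.
choices-in-length : (A : Fin a → List ℕ) → Disjointed A → ∀ {m} xs → length xs ≡ m + a →
  length (choices (λ i → filter (_∈? A i) xs)) ≤ 2 ^ m
choices-in-length {a} A disj {m} xs len = *-cancelˡ-≤ (2 ^ a) {{m^n≢0 2 a}} (begin
  2 ^ a * length (choices B)               ≡⟨ cong (2 ^ a *_) (length-choices B) ⟩
  2 ^ a * ∏ (length ∘ B)                   ≤⟨ 2^*∏≤2^sum (length ∘ B) ⟩
  2 ^ sum (tabulate (length ∘ B))          ≤⟨ ^-monoʳ-≤ 2 (disjointed-count A disj xs) ⟩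
  2 ^ length xs                            ≡⟨ cong (2 ^_) (trans len (+-comm m a)) ⟩
  2 ^ (a + m)                              ≡⟨ ^-distribˡ-+-* 2 a m ⟩
  2 ^ a * 2 ^ m                            ∎)
  where
  open ≤-Reasoning
  B : Fin a → List ℕ
  B i = filter (_∈? A i) xs

-- Bernoulli's inequality and the cost of the colours of row 0

bernoulli : ∀ q t → (q + t) * q ^ t ≤ q * (suc q) ^ t
bernoulli q zero = ≤-reflexive (cong (_* 1) (+-identityʳ q))
bernoulli q (suc t) = begin
  (q + suc t) * (q * q ^ t)              ≡⟨ step₁ q t (q ^ t) ⟩
  (q * (q + t) + q) * q ^ t              ≤⟨ *-monoˡ-≤ (q ^ t) (+-monoʳ-≤ (q * (q + t)) (m≤m+n q t)) ⟩
  (q * (q + t) + (q + t)) * q ^ t        ≡⟨ step₂ q t (q ^ t) ⟩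
  suc q * ((q + t) * q ^ t)              ≤⟨ *-monoʳ-≤ (suc q) (bernoulli q t) ⟩
  suc q * (q * suc q ^ t)                ≡⟨ step₃ q (suc q) (suc q ^ t) ⟩
  q * (suc q * suc q ^ t)                ∎
  where
  open ≤-Reasoning
  step₁ : ∀ q t z → (q + suc t) * (q * z) ≡ (q * (q + t) + q) * z
  step₁ = solve-∀
  step₂ : ∀ q t z → (q * (q + t) + (q + t)) * z ≡ suc q * ((q + t) * z)
  step₂ = solve-∀
  step₃ : ∀ x y z → y * (x * z) ≡ x * (y * z)
  step₃ = solve-∀

-- For positive `h` the hypothesis reads c / h ≤ 1 + t / q, and Bernoulli bounds the right side by
-- (1 + 1 / q) ^ t.
bernoulli-weighted : ∀ q .{{_ : NonZero q}} t h c → c * q ≤ h * (q + t) →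
  c * q ^ t ≤ h * suc q ^ t
bernoulli-weighted q t h c le = *-cancelˡ-≤ q (begin
  q * (c * q ^ t)          ≡⟨ step₁ q c (q ^ t) ⟩
  c * q * q ^ t            ≤⟨ *-monoˡ-≤ (q ^ t) le ⟩
  h * (q + t) * q ^ t      ≡⟨ *-assoc h (q + t) (q ^ t) ⟩
  h * ((q + t) * q ^ t)    ≤⟨ *-monoʳ-≤ h (bernoulli q t) ⟩
  h * (q * suc q ^ t)      ≡⟨ step₂ h q (suc q ^ t) ⟩
  q * (h * suc q ^ t)      ∎)
  where
  open ≤-Reasoning
  step₁ : ∀ q c z → q * (c * z) ≡ c * q * z
  step₁ = solve-∀
  step₂ : ∀ h q z → h * (q * z) ≡ q * (h * z)
  step₂ = solve-∀

-- Here `t` counts the entries of row 0 in one list that lacks its own colour of row 0, and `h` is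
-- twice the discounted size of that list. Each of the `t` entries costs at most a factor q / (q +
-- 1).
unblocked-bound : ∀ q .{{_ : NonZero q}} t h → t ≤ q → 2 * suc q ≤ h + t →
  2 * suc q * q ^ t ≤ h * suc q ^ t
unblocked-bound q t h t≤q le with r , refl ← m≤n⇒∃[o]m+o≡n t≤q =
  bernoulli-weighted q t h (2 * suc q) (begin
    -- With q = t + r, the added term is the excess of (2 q + 2 - t) (q + t) over 2 (q + 1) q.
    2 * suc q * q                   ≤⟨ m≤m+n _ (t * r + 2 * t) ⟩
    2 * suc q * q + (t * r + 2 * t) ≡⟨ id₁ t r ⟩
    (t + 2 * r + 2) * (q + t)
      ≤⟨ *-monoˡ-≤ (q + t) (+-cancelʳ-≤ t _ _ (≤-trans (≤-reflexive (id₂ t r)) le)) ⟩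
    h * (q + t)                     ∎)
  where
  open ≤-Reasoning
  id₁ : ∀ t r → 2 * suc (t + r) * (t + r) + (t * r + 2 * t) ≡ (t + 2 * r + 2) * (t + r + t)
  id₁ = solve-∀
  id₂ : ∀ t r → t + 2 * r + 2 + t ≡ 2 * suc (t + r)
  id₂ = solve-∀

-- Now the list contains its own colour of row 0. Losing it turns q + 1 choices into q, which is one
-- factor q / (q + 1); the other `t` entries are treated as before.
blocked-bound : ∀ q .{{_ : NonZero q}} t h → suc t ≤ q → 2 * q ≤ h + t →
  2 * suc q * q ^ suc t ≤ h * suc q ^ suc t
blocked-bound q t h t<q le with r , refl ← m≤n⇒∃[o]m+o≡n (<⇒≤ t<q) = begin
  2 * suc q * (q * q ^ t)   ≡⟨ id₃ q (q ^ t) ⟩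
  suc q * (2 * q * q ^ t)   ≤⟨ *-monoʳ-≤ (suc q) (bernoulli-weighted q t h (2 * q) core) ⟩
  suc q * (h * suc q ^ t)   ≡⟨ id₄ (suc q) h (suc q ^ t) ⟩
  h * (suc q * suc q ^ t)   ∎
  where
  open ≤-Reasoning
  id₁ : ∀ t r → 2 * (t + r) * (t + r) + t * r ≡ (t + 2 * r) * (t + r + t)
  id₁ = solve-∀
  id₂ : ∀ t r → t + 2 * r + t ≡ 2 * (t + r)
  id₂ = solve-∀
  id₃ : ∀ q z → 2 * suc q * (q * z) ≡ suc q * (2 * q * z)
  id₃ = solve-∀
  id₄ : ∀ p h z → p * (h * z) ≡ h * (p * z)
  id₄ = solve-∀
  core : 2 * q * q ≤ h * (q + t)
  core = begin
    2 * q * q               ≤⟨ m≤m+n _ (t * r) ⟩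
    2 * q * q + t * r       ≡⟨ id₁ t r ⟩
    (t + 2 * r) * (q + t)   ≤⟨ *-monoˡ-≤ (q + t) (+-cancelʳ-≤ t _ _ (≤-trans (≤-reflexive (id₂ t r)) le)) ⟩
    h * (q + t)             ∎

-- With T the sum of the `t i`, multiplying the hypotheses gives ∏ h ≥ (2 (q + 1)) ^ a (q / (q + 1))
-- ^ T. The exponent T is at most `a`, so this is at least (2 q) ^ a. Denominators are cleared by (q
-- + 1) ^ T.
∏-tradeoff : ∀ q .{{_ : NonZero q}} (h t : Fin a → ℕ) →
  (∀ i → 2 * suc q * q ^ t i ≤ h i * suc q ^ t i) → sum (tabulate t) ≤ a → (2 * q) ^ a ≤ ∏ h
∏-tradeoff {a} q h t le T≤a with s , T+s≡a ← m≤n⇒∃[o]m+o≡n T≤a =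
  *-cancelʳ-≤ _ _ (suc q ^ T) {{m^n≢0 (suc q) T}} (begin
    (2 * q) ^ a * suc q ^ T                   ≡⟨ cong (_* suc q ^ T) (^-distribʳ-* 2 q a) ⟩
    2 ^ a * q ^ a * suc q ^ T                 ≡⟨ cong (λ e → 2 ^ a * q ^ e * suc q ^ T) T+s≡a ⟨
    2 ^ a * q ^ (T + s) * suc q ^ T           ≡⟨ cong (λ z → 2 ^ a * z * suc q ^ T) (^-distribˡ-+-* q T s) ⟩
    2 ^ a * (q ^ T * q ^ s) * suc q ^ T       ≡⟨ id₁ (2 ^ a) (q ^ T) (q ^ s) (suc q ^ T) ⟩
    2 ^ a * (suc q ^ T * q ^ s) * q ^ T
      ≤⟨ *-monoˡ-≤ (q ^ T) (*-monoʳ-≤ (2 ^ a) (*-monoʳ-≤ (suc q ^ T) (^-monoˡ-≤ s (n≤1+n q)))) ⟩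
    2 ^ a * (suc q ^ T * suc q ^ s) * q ^ T   ≡⟨ cong (λ z → 2 ^ a * z * q ^ T) (^-distribˡ-+-* (suc q) T s) ⟨
    2 ^ a * suc q ^ (T + s) * q ^ T           ≡⟨ cong (λ e → 2 ^ a * suc q ^ e * q ^ T) T+s≡a ⟩
    2 ^ a * suc q ^ a * q ^ T                 ≡⟨ cong (_* q ^ T) (^-distribʳ-* 2 (suc q) a) ⟨
    (2 * suc q) ^ a * q ^ T                   ≤⟨ multiply (2 * suc q) h t le ⟩
    ∏ h * suc q ^ T                           ∎)
  where
  open ≤-Reasoning
  T = sum (tabulate t)
  id₁ : ∀ w x y z → w * (x * y) * z ≡ w * (z * y) * x
  id₁ = solve-∀
  multiply : ∀ {a} c (h t : Fin a → ℕ) → (∀ i → c * q ^ t i ≤ h i * suc q ^ t i) →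
    c ^ a * q ^ sum (tabulate t) ≤ ∏ h * suc q ^ sum (tabulate t)
  multiply {zero} c h t le = ≤-refl
  multiply {suc a} c h t le = begin
    c * c ^ a * q ^ (t zero + T′)                     ≡⟨ cong (c * c ^ a *_) (^-distribˡ-+-* q (t zero) T′) ⟩
    c * c ^ a * (q ^ t zero * q ^ T′)                 ≡⟨ *-interchange c (c ^ a) (q ^ t zero) (q ^ T′) ⟩
    c * q ^ t zero * (c ^ a * q ^ T′)
      ≤⟨ *-mono-≤ (le zero) (multiply c (h ∘ suc) (t ∘ suc) (le ∘ suc)) ⟩
    h zero * suc q ^ t zero * (∏ (h ∘ suc) * suc q ^ T′)
      ≡⟨ *-interchange (h zero) (suc q ^ t zero) _ (suc q ^ T′) ⟩
    h zero * ∏ (h ∘ suc) * (suc q ^ t zero * suc q ^ T′)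
      ≡⟨ cong (∏ h *_) (^-distribˡ-+-* (suc q) (t zero) T′) ⟨
    ∏ h * suc q ^ (t zero + T′)                       ∎
    where T′ = sum (tabulate (t ∘ suc))

-- Total weight of the colourings built row by row

colours : Vec ℕ a → List ℕ
colours r = tabulate (lookup r)

∈-colours : (r : Vec ℕ a) (i : Fin a) → lookup r i ∈ colours r
∈-colours r = ∈-tabulate⁺

-- Twice the factor 1/2 or 1 contributed by one colour x.
discount : List ℕ → ℕ → ℕ
discount ys x with x ∈? ys
... | yes _ = 1
... | no  _ = 2

∑-discount : ∀ ys xs → ∑ (discount ys) xs + length (filter (_∈? ys) xs) ≡ 2 * length xs
∑-discount ys [] = refl
∑-discount ys (x ∷ xs) with x ∈? ys
... | yes _ = trans (cong suc (+-suc _ _)) (trans (cong (2 +_) (∑-discount ys xs)) (sym (*-suc 2 (length xs))))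
... | no _ = trans (cong (2 +_) (∑-discount ys xs)) (sym (*-suc 2 (length xs)))

-- Both cases give the same price: an entry of row 0 in `A` costs at most a factor q / (q + 1),
-- whether it is struck or only discounted.
choice-factor : ∀ q .{{_ : NonZero q}} {A} (r : Vec ℕ a) i → a ≤ q → Unique A → suc q ≤ length A →
  let t = length (filter (_∈? A) (colours r)) in
  2 * suc q * q ^ t ≤ ∑ (discount (colours r)) (A ∖ [ lookup r i ]) * suc q ^ t
choice-factor {a} q {A} r i a≤q uA longA with lookup r i ∈? A
... | no x∉A = unblocked-bound q t h t≤q
  (≤-trans (*-monoʳ-≤ 2 longB) (≤-trans (≤-reflexive (sym (∑-discount ys B))) (+-monoʳ-≤ h shared≤t)))
  where
  ys = colours r
  B = A ∖ [ lookup r i ]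
  h = ∑ (discount ys) B
  t = length (filter (_∈? A) ys)
  t≤q : t ≤ q
  t≤q = ≤-trans (length-filter (_∈? A) ys) (≤-trans (≤-reflexive (length-tabulate (lookup r))) a≤q)
  longB : suc q ≤ length B
  longB = +-cancelʳ-≤ 1 _ _ (≤-trans (≤-reflexive (+-comm (suc q) 1)) (≤-trans (s≤s longA) (length-∖-< uA (here refl) x∉A)))
  shared≤t : length (filter (_∈? ys) B) ≤ t
  shared≤t = ⊆⇒length≤ (Unique.filter⁺ (_∈? ys) (∖-unique [ lookup r i ] uA)) λ p →
    let p₁ , p₂ = ∈-filter⁻ (_∈? ys) {xs = B} p in
    ∈-filter⁺ (_∈? A) p₂ (proj₁ (∈-∖⁻ [ lookup r i ] p₁))
... | yes x∈A = with-t (length (filter (_∈? A) ys)) shared<t t≤q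
  where
  ys = colours r
  B = A ∖ [ lookup r i ]
  h = ∑ (discount ys) B
  t≤q : length (filter (_∈? A) ys) ≤ q
  t≤q = ≤-trans (length-filter (_∈? A) ys) (≤-trans (≤-reflexive (length-tabulate (lookup r))) a≤q)
  longB : q ≤ length B
  longB = length-∖-[] (lookup r i) uA longA
  -- The own colour of row 0 is counted in `A` but no longer occurs in `B`.
  shared<t : suc (length (filter (_∈? ys) B)) ≤ length (filter (_∈? A) ys)
  shared<t = ⊆⇒length≤
    (∉⇒unique-∷ (λ p → proj₂ (∈-∖⁻ {xs = A} [ lookup r i ] (proj₁ (∈-filter⁻ (_∈? ys) {xs = B} p))) (here refl))
      (Unique.filter⁺ (_∈? ys) (∖-unique [ lookup r i ] uA)))
    λ { (here refl) → ∈-filter⁺ (_∈? A) (∈-colours r i) x∈A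
      ; (there p) → let p₁ , p₂ = ∈-filter⁻ (_∈? ys) {xs = B} p in
          ∈-filter⁺ (_∈? A) p₂ (proj₁ (∈-∖⁻ [ lookup r i ] p₁)) }
  -- The count is positive; generalising it to a variable allows matching it as a successor, as
  -- `blocked-bound` requires.
  with-t : ∀ t → suc (length (filter (_∈? ys) B)) ≤ t → t ≤ q → 2 * suc q * q ^ t ≤ h * suc q ^ t
  with-t (suc t) (s≤s le) t≤q = blocked-bound q t h t≤q
    (≤-trans (*-monoʳ-≤ 2 longB) (≤-trans (≤-reflexive (sym (∑-discount ys B))) (+-monoʳ-≤ h le)))

row-weight-bound : ∀ q .{{_ : NonZero q}} (A : Fin a → List ℕ) (r : Vec ℕ a) → a ≤ q →
  (∀ i → Unique (A i)) → (∀ i → suc q ≤ length (A i)) → Disjointed A →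
  (2 * q) ^ a ≤ ∑ (weigh (discount (colours r))) (choices (λ i → A i ∖ [ lookup r i ]))
row-weight-bound {a} q A r a≤q uA longA disj =
  subst ((2 * q) ^ a ≤_) (sym (∑-choices (discount (colours r)) (λ i → A i ∖ [ lookup r i ])))
  (∏-tradeoff q _ (λ i → length (filter (_∈? A i) (colours r)))
    (λ i → choice-factor q r i a≤q (uA i) (longA i))
    (≤-trans (disjointed-count A disj (colours r)) (≤-reflexive (length-tabulate (lookup r)))))

-- `r` is row 0. Its colours are struck from a row only when that row is chosen, so that
-- `row-weight-bound` sees the unstruck list; the colours of every other row are struck from all
-- later rows at once.
extensions : Vec ℕ a → (Fin m → Fin a → List ℕ) → List (Vec (Vec ℕ a) m)
extensions {m = zero} r A = [ [] ]
extensions {m = suc m} r A =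
  branch (choices (λ i → A zero i ∖ [ lookup r i ]))
    (λ s → extensions r (λ v i → A (suc v) i ∖ [ lookup s i ]))

extensions-unique : ∀ (r : Vec ℕ a) (A : Fin m → Fin a → List ℕ) →
  (∀ v i → Unique (A v i)) → Unique (extensions r A)
extensions-unique {m = zero} r A u = [] ∷ []
extensions-unique {m = suc m} r A u = branch-unique
  (choices-unique λ i → ∖-unique [ lookup r i ] (u zero i))
  (λ s → extensions-unique r _ λ v i → ∖-unique [ lookup s i ] (u (suc v) i))

-- The guaranteed scaled weight of all extensions by `m` rows; a row with `m` rows still to follow
-- contributes (2 (m + a)) ^ a.
min-weight : ℕ → ℕ → ℕ
min-weight a zero = 1
min-weight a (suc m) = (2 * (m + a)) ^ a * min-weight a m

-- The factor of a row depends only on that row and row 0, so rows can be bounded one at a time.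
-- Each chosen row shortens the later lists by at most one.
extensions-weight : .{{_ : NonZero a}} (r : Vec ℕ a) (A : Fin m → Fin a → List ℕ) →
  (∀ v i → Unique (A v i)) → (∀ v i → m + a ≤ length (A v i)) → (∀ v → Disjointed (A v)) →
  min-weight a m ≤ ∑ (weigh (weigh (discount (colours r)))) (extensions r A)
extensions-weight {m = zero} r A u long disj = ≤-refl
extensions-weight {a} {m = suc m} r A u long disj = begin
  (2 * (m + a)) ^ a * min-weight a m
    ≤⟨ *-monoˡ-≤ (min-weight a m) (row-weight-bound (m + a) {{>-nonZero (≤-trans (>-nonZero⁻¹ a) (m≤n+m a m))}}
           (A zero) r (m≤n+m a m) (u zero) (long zero) (disj zero)) ⟩
  ∑ w rows * min-weight a m
    ≡⟨ ∑-*ʳ (min-weight a m) w rows ⟨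
  ∑ (λ s → w s * min-weight a m) rows
    ≤⟨ ∑-mono rows (λ s → *-monoʳ-≤ (w s) (extensions-weight r _ (λ v i → ∖-unique [ lookup s i ] (u (suc v) i))
         (λ v i → length-∖-[] (lookup s i) (u (suc v) i) (long (suc v) i))
         λ v p q → disj (suc v) (proj₁ (∈-∖⁻ [ lookup s _ ] p)) (proj₁ (∈-∖⁻ [ lookup s _ ] q)))) ⟩
  ∑ (λ s → w s * ∑ (weigh w) (rest s)) rows
    ≡⟨ ∑-cong rows (λ s → ∑-*ˡ (w s) (weigh w) (rest s)) ⟨
  ∑ (λ s → ∑ (λ c → w s * weigh w c) (rest s)) rows
    ≡⟨ ∑-branch (weigh w) rows rest ⟨
  ∑ (weigh w) (extensions r A) ∎
  where
  open ≤-Reasoning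
  w = weigh (discount (colours r))
  rows = choices (λ i → A zero i ∖ [ lookup r i ])
  rest = λ s → extensions r (λ v i → A (suc v) i ∖ [ lookup s i ])

record ProperRows (A : Fin m → Fin a → List ℕ) (c : Vec (Vec ℕ a) m) : Set where
  constructor proper-rows
  field
    from-lists    : ∀ v i → lookup (lookup c v) i ∈ A v i
    rows-distinct : ∀ u v → u ≢ v → ∀ i → lookup (lookup c u) i ≢ lookup (lookup c v) i

open ProperRows

proper-∷ : {A : Fin (suc m) → Fin a → List ℕ} {r : Vec ℕ a} {c : Vec (Vec ℕ a) m} →
  (∀ i → lookup r i ∈ A zero i) → ProperRows (λ v i → A (suc v) i ∖ [ lookup r i ]) c →
  ProperRows A (r ∷ c)
proper-∷ {m = m} {a} {A} {r} {c} r∈ p = proper-rows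
  (λ { zero → r∈ ; (suc v) i → proj₁ (split v i) })
  λ { zero zero z≢z → contradiction refl z≢z
    ; zero (suc v) _ i eq → proj₂ (split v i) (here (sym eq))
    ; (suc u) zero _ i eq → proj₂ (split u i) (here eq)
    ; (suc u) (suc v) u≢v → rows-distinct p u v (u≢v ∘ cong suc) }
  where
  split : ∀ v i → lookup (lookup c v) i ∈ A (suc v) i × lookup (lookup c v) i ∉ [ lookup r i ]
  split v i = ∈-∖⁻ {xs = A (suc v) i} [ lookup r i ] (from-lists p v i)

extensions-proper : ∀ (r : Vec ℕ a) (A : Fin m → Fin a → List ℕ) {c} → c ∈ extensions r A →
  ProperRows (λ v i → A v i ∖ [ lookup r i ]) c
extensions-proper {m = zero} r A {[]} c∈ = proper-rows (λ ()) (λ ())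
extensions-proper {m = suc m} r A {s ∷ c} c∈ with s∈ , c∈′ ← ∈-branch⁻ (choices _) c∈ =
  proper-∷ (∈-choices⁻ _ s∈) (proper-rows (λ v i → ∖-swap (A (suc v) i) (from-lists rest v i)) (rows-distinct rest))
  where
  rest : ProperRows (λ v i → A (suc v) i ∖ [ lookup s i ] ∖ [ lookup r i ]) c
  rest = extensions-proper r (λ v i → A (suc v) i ∖ [ lookup s i ]) c∈′
  -- `extensions` strikes the colour of `s` before that of `r`, whereas `proper-∷` expects the
  -- opposite order.
  ∖-swap : ∀ xs {ys zs x} → x ∈ xs ∖ ys ∖ zs → x ∈ xs ∖ zs ∖ ys
  ∖-swap xs {ys} {zs} p with p′ , x∉zs ← ∈-∖⁻ {xs = xs ∖ ys} zs p
    with x∈ , x∉ys ← ∈-∖⁻ {xs = xs} ys p′ = ∈-∖⁺ (∈-∖⁺ x∈ x∉zs) x∉ys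

-- Upper bounds for the weight of one colouring

weigh-bound : ∀ (f : X → ℕ) k K (v : Vec X n) → (∀ i → f (lookup v i) * k ≤ K) → weigh f v * k ^ n ≤ K ^ n
weigh-bound f k K [] le = ≤-refl
weigh-bound {n = suc n} f k K (x ∷ v) le = begin
  f x * weigh f v * (k * k ^ n)     ≡⟨ *-interchange (f x) (weigh f v) k (k ^ n) ⟩
  f x * k * (weigh f v * k ^ n)     ≤⟨ *-mono-≤ (le zero) (weigh-bound f k K v (le ∘ suc)) ⟩
  K * K ^ n                         ∎
  where
  open ≤-Reasoning

weigh-≤ : ∀ (f : X → ℕ) K (v : Vec X n) → (∀ i → f (lookup v i) ≤ K) → weigh f v ≤ K ^ n
weigh-≤ f K [] le = ≤-refl
weigh-≤ f K (x ∷ v) le = *-mono-≤ (le zero) (weigh-≤ f K v (le ∘ suc))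

discount≤2 : ∀ ys x → discount ys x ≤ 2
discount≤2 ys x with x ∈? ys
... | yes _ = s≤s z≤n
... | no  _ = ≤-refl

discounted-row : ∀ ys (s : Vec ℕ a) i → lookup s i ∈ ys → weigh (discount ys) s * 2 ≤ 2 ^ a
discounted-row {suc a} ys (x ∷ s) zero x∈ with x ∈? ys
... | no x∉ = contradiction x∈ x∉
... | yes _ = begin
  1 * weigh (discount ys) s * 2   ≡⟨ cong (_* 2) (*-identityˡ (weigh (discount ys) s)) ⟩
  weigh (discount ys) s * 2
    ≤⟨ *-monoˡ-≤ 2 (weigh-≤ (discount ys) 2 s (λ i → discount≤2 ys (lookup s i))) ⟩
  2 ^ a * 2                       ≡⟨ *-comm (2 ^ a) 2 ⟩
  2 ^ suc a                       ∎
  where open ≤-Reasoning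
discounted-row {suc a} ys (x ∷ s) (suc i) x∈ = begin
  discount ys x * weigh (discount ys) s * 2     ≡⟨ *-assoc (discount ys x) _ 2 ⟩
  discount ys x * (weigh (discount ys) s * 2)   ≤⟨ *-mono-≤ (discount≤2 ys x) (discounted-row ys s i x∈) ⟩
  2 * 2 ^ a                                     ∎
  where open ≤-Reasoning

-- Already scaled by (2 ^ a) ^ m; row 0 itself contributes no factor.
weight : Vec (Vec ℕ a) (suc m) → ℕ
weight (r ∷ c) = weigh (weigh (discount (colours r))) c

weight-≤ : (c : Vec (Vec ℕ a) (suc m)) → weight c ≤ (2 ^ a) ^ m
weight-≤ {a} (r ∷ c) = weigh-≤ _ (2 ^ a) c λ v → weigh-≤ _ 2 (lookup c v) λ i → discount≤2 (colours r) _

-- Each of the `m` later rows contains the colour `x` of row 0 and so loses a factor of at least 2.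
weight-halved : (c : Vec (Vec ℕ a) (suc m)) {x : ℕ} → (∀ v → x ∈ colours (lookup c v)) →
  weight c * 2 ^ m ≤ (2 ^ a) ^ m
weight-halved {a} (r ∷ c) {x} x∈ = weigh-bound _ 2 (2 ^ a) c row
  where
  row : ∀ v → weigh (discount (colours r)) (lookup c v) * 2 ≤ 2 ^ a
  row v with i , refl ← ∈-tabulate⁻ {f = lookup (lookup c v)} (x∈ (suc v)) =
    discounted-row (colours r) (lookup c v) i (x∈ zero)

colourings : (Fin (suc m) → Fin a → List ℕ) → List (Vec (Vec ℕ a) (suc m))
colourings A = branch (choices (A zero)) (λ r → extensions r (A ∘ suc))

-- The colourings defeated by one right copy

residual : (Fin m → List ℕ) → Vec (Vec ℕ a) m → Fin m → List ℕ
residual S c v = S v ∖ colours (lookup c v)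

lookup-ext : {u v : Vec X n} → (∀ i → lookup u i ≡ lookup v i) → u ≡ v
lookup-ext {u = []} {[]} eq = refl
lookup-ext {u = x ∷ u} {y ∷ v} eq = cong₂ _∷_ (eq zero) (lookup-ext (eq ∘ suc))

∑≤length* : (f : X → ℕ) (k K : ℕ) (xs : List X) → (∀ {x} → x ∈ xs → f x * k ≤ K) →
  ∑ f xs * k ≤ length xs * K
∑≤length* f k K [] le = z≤n
∑≤length* f k K (x ∷ xs) le = ≤-trans (≤-reflexive (*-distribʳ-+ k (f x) _))
  (+-mono-≤ (le (here refl)) (∑≤length* f k K xs (le ∘ there)))

-- Either there is at most one summand, bounded by `K`, or all summands are light and there are at
-- most `k` of them.
∑-bounded : (f : X → ℕ) (k K : ℕ) .{{_ : NonZero k}} (xs : List X) → Unique xs →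
  length xs ≤ k → (∀ {x} → x ∈ xs → f x ≤ K) →
  (∀ {x y} → x ∈ xs → y ∈ xs → x ≢ y → f x * k ≤ K) → ∑ f xs ≤ K
∑-bounded f k K [] u len heavy light = z≤n
∑-bounded f k K (x ∷ []) u len heavy light = ≤-trans (≤-reflexive (+-identityʳ (f x))) (heavy (here refl))
∑-bounded f k K xs@(x ∷ y ∷ zs) u@((x≢y ∷ _) ∷ _) len heavy light = *-cancelʳ-≤ _ _ k (begin
  ∑ f xs * k      ≤⟨ ∑≤length* f k K xs each ⟩
  length xs * K   ≤⟨ *-monoˡ-≤ K len ⟩
  k * K           ≡⟨ *-comm k K ⟩
  K * k           ∎)
  where
  open ≤-Reasoning
  each : ∀ {z} → z ∈ xs → f z * k ≤ K
  each (here refl) = light (here refl) (there (here refl)) x≢y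
  each (there z∈) = light (there z∈) (here refl) λ { refl → unique-head∉ u z∈ }

module _ {A : Fin (suc m) → Fin a → List ℕ} (disj : ∀ v → Disjointed (A v))
         {S : Fin (suc m) → List ℕ} (uS : ∀ v → Unique (S v)) (lenS : ∀ v → length (S v) ≡ m + a) where

  private
    Bad : Vec (Vec ℕ a) (suc m) → Set
    Bad c = ProperRows A c × Obstruction (residual S c)

  length-residual : ∀ c v → m ≤ length (residual S c v)
  length-residual c v = +-cancelʳ-≤ a _ _ (≤-trans (≤-reflexive (sym (lenS v)))
    (subst (λ l → length (S v) ≤ length (residual S c v) + l) (length-tabulate (lookup (lookup c v)))
      (length-∖ (colours (lookup c v)) (uS v))))

  -- A colour outside `S v` strikes nothing from it, so the residual list would have more than `m`
  -- colours.
  obstructed-⊆ : ∀ c → Obstruction (residual S c) → ∀ v i → lookup (lookup c v) i ∈ S v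
  obstructed-⊆ c (short , _) v i = decidable-stable (x ∈? S v) λ x∉ → <⇒≱ (begin-strict
    m + a                                            ≡⟨ lenS v ⟨
    length (S v)                                     <⟨ length-∖-< (uS v) (∈-colours row i) x∉ ⟩
    length (residual S c v) + length (colours row)
      ≡⟨ cong (length (residual S c v) +_) (length-tabulate (lookup row)) ⟩
    length (residual S c v) + a                      ∎)
    (+-monoˡ-≤ a (short v))
    where
    open ≤-Reasoning
    row = lookup c v
    x = lookup row i

  -- The residual list at `v` has at least `m` colours and lies inside the one at `zero`, which has
  -- at most `m`; so the two agree as sets.
  obstructed-⊇ : ∀ c → Obstruction (residual S c) → ∀ v → residual S c zero ⊆ residual S c v
  obstructed-⊇ c (short , sub) v {x} x∈ = decidable-stable (x ∈? residual S c v) λ x∉ →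
    <⇒≱ (s≤s (length-residual c v)) (≤-trans
      (⊆⇒length≤ (∉⇒unique-∷ x∉ (∖-unique _ (uS v)))
        λ { (here refl) → x∈ ; (there p) → All.lookup (sub v) p })
      (short zero))

  -- Row 0 fixes the common residual list, hence the set of colours struck from each `S v`.
  -- Disjointness of the lists at `v` then fixes the index of each colour.
  obstructed-determined : ∀ {c c′} → Bad c → Bad c′ → head c ≡ head c′ → c ≡ c′
  obstructed-determined {r ∷ c} {r ∷ c′} (p , ob@(_ , sub)) (p′ , ob′) refl =
    lookup-ext λ v → lookup-ext (same v)
    where
    same : ∀ v i → lookup (lookup (r ∷ c) v) i ≡ lookup (lookup (r ∷ c′) v) i
    same v i with ∈-tabulate⁻ {f = lookup (lookup (r ∷ c′) v)} (decidable-stable (x ∈? row′) λ x∉row′ →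
        proj₂ (∈-∖⁻ {xs = S v} row (obstructed-⊇ (r ∷ c) ob v
          (All.lookup (proj₂ ob′ v) (∈-∖⁺ (obstructed-⊆ (r ∷ c) ob v i) x∉row′)))) (∈-colours (lookup (r ∷ c) v) i))
      where
      x = lookup (lookup (r ∷ c) v) i
      row = colours (lookup (r ∷ c) v)
      row′ = colours (lookup (r ∷ c′) v)
    ... | i′ , eq with disj v (from-lists p v i) (subst (_∈ A v i′) (sym eq) (from-lists p′ v i′))
    ... | refl = eq

  -- If c′ ≠ c is obstructed as well, a colour of row 0 of c that c′ avoids there lies in the common
  -- residual list of c′, hence in every S v, but not in that of c: so c uses it in every row.
  obstructed-light : ∀ {c c′} → Bad c → Bad c′ → c ≢ c′ → weight c * 2 ^ m ≤ (2 ^ a) ^ m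
  obstructed-light {c} {c′} bad@(p , ob) bad′@(p′ , ob′) c≢c′
    with Fin.any? (λ i → ¬? (lookup (lookup c zero) i ≟ lookup (lookup c′ zero) i))
  ... | no same = contradiction (obstructed-determined bad bad′ (heads-equal c c′ λ i →
                    decidable-stable (_ ≟ _) λ ne → same (i , ne))) c≢c′
    where
    heads-equal : ∀ (c c′ : Vec (Vec ℕ a) (suc m)) →
      (∀ i → lookup (lookup c zero) i ≡ lookup (lookup c′ zero) i) → head c ≡ head c′
    heads-equal (r ∷ _) (r′ ∷ _) eq = lookup-ext eq
  ... | yes (i , x≢) = weight-halved c in-every-row
    where
    x = lookup (lookup c zero) i
    x∉row′ : x ∉ colours (lookup c′ zero)
    x∉row′ x∈ with i′ , eq ← ∈-tabulate⁻ {f = lookup (lookup c′ zero)} x∈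
      with refl ← disj zero (from-lists p zero i) (subst (_∈ A zero i′) (sym eq) (from-lists p′ zero i′)) = x≢ eq
    x∈residual′ : x ∈ residual S c′ zero
    x∈residual′ = ∈-∖⁺ (obstructed-⊆ c ob zero i) x∉row′
    in-every-row : ∀ v → x ∈ colours (lookup c v)
    in-every-row v = decidable-stable (x ∈? colours (lookup c v)) λ x∉row →
      proj₂ (∈-∖⁻ {xs = S zero} (colours (lookup c zero)) (All.lookup (proj₂ ob v)
        (∈-∖⁺ (proj₁ (∈-∖⁻ {xs = S v} (colours (lookup c′ v)) (obstructed-⊇ c′ ob′ v x∈residual′))) x∉row)))
        (∈-colours (lookup c zero) i)

  -- Row 0 determines an obstructed colouring and has its entries in `S zero`, so
  -- `choices-in-length` allows at most 2 ^ m of them; if there are two, all are light.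
  obstructed-weight : ∀ cs → Unique cs → (∀ {c} → c ∈ cs → Bad c) → ∑ weight cs ≤ (2 ^ a) ^ m
  obstructed-weight cs u bad = ∑-bounded weight (2 ^ m) ((2 ^ a) ^ m) {{m^n≢0 2 m}} cs u
    (≤-trans (injection⇒length≤ head u (λ p q → obstructed-determined (bad p) (bad q)) first-row∈)
             (choices-in-length (A zero) (disj zero) (S zero) (lenS zero)))
    (λ {c} _ → weight-≤ c)
    (λ p q → obstructed-light (bad p) (bad q))
    where
    first-row∈ : ∀ {c} → c ∈ cs → head c ∈ choices (λ i → filter (_∈? A zero i) (S zero))
    first-row∈ {r ∷ c} c∈ with p , ob ← bad c∈ = ∈-choices⁺ _ λ i →
      ∈-filter⁺ (_∈? A zero i) (obstructed-⊆ (r ∷ c) ob zero i) (from-lists p zero i)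

-- Averaging over all left colourings

∑-filter : {P : X → Set} (P? : Decidable P) (f : X → ℕ) (xs : List X) →
  ∑ f xs ≡ ∑ f (filter P? xs) + ∑ f (filter (¬? ∘ P?) xs)
∑-filter P? f [] = refl
∑-filter P? f (x ∷ xs) with P? x
... | yes _ = trans (cong (f x +_) (∑-filter P? f xs)) (sym (+-assoc (f x) _ _))
... | no _ = trans (cong (f x +_) (∑-filter P? f xs)) (x+[y+z] (f x) (∑ f (filter P? xs)) _)
  where
  x+[y+z] : ∀ x y z → x + (y + z) ≡ y + (x + z)
  x+[y+z] = solve-∀

-- A weighted union bound, discarding one bad set after another. Bounding every duplicate-free `ys`
-- lets the hypothesis pass to the elements that remain.
avoid-all : ∀ {b} {Bad : Fin b → X → Set} (bad? : ∀ j → Decidable (Bad j)) (f : X → ℕ) (W : ℕ) xs →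
  Unique xs →
  (∀ j ys → Unique ys → (∀ {y} → y ∈ ys → y ∈ xs × Bad j y) → ∑ f ys ≤ W) →
  b * W < ∑ f xs → ∃ λ x → x ∈ xs × (∀ j → ¬ Bad j x)
avoid-all {b = zero} bad? f W (x ∷ xs) u le lt = x , here refl , λ ()
avoid-all {b = suc b} bad? f W xs u le lt =
  let x , x∈ , good = avoid-all (bad? ∘ suc) f W ys (Unique.filter⁺ (¬? ∘ bad? zero) u)
        (λ j zs uz sub → le (suc j) zs uz λ z∈ →
          proj₁ (∈-filter⁻ (¬? ∘ bad? zero) (proj₁ (sub z∈))) , proj₂ (sub z∈))
        (+-cancelˡ-< W _ _ (begin-strict
          W + b * W                                    <⟨ lt ⟩
          ∑ f xs                                       ≡⟨ ∑-filter (bad? zero) f xs ⟩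
          ∑ f (filter (bad? zero) xs) + ∑ f ys
            ≤⟨ +-monoˡ-≤ (∑ f ys) (le zero _ (Unique.filter⁺ (bad? zero) u) (∈-filter⁻ (bad? zero))) ⟩
          W + ∑ f ys                                   ∎))
      x∈xs , ¬bad₀ = ∈-filter⁻ (¬? ∘ bad? zero) x∈
  in x , x∈xs , λ { zero → ¬bad₀ ; (suc j) → good j }
  where
  open ≤-Reasoning
  ys = filter (¬? ∘ bad? zero) xs

-- The rising factorial a (a + 1) ⋯ (a + m), which has m + 1 factors.
rising : ℕ → ℕ → ℕ
rising a zero = a
rising a (suc m) = (suc m + a) * rising a m

rising-! : ∀ a m → rising (suc a) m * a ! ≡ (m + suc a) !
rising-! a zero = refl
rising-! a (suc m) = trans (*-assoc (suc m + suc a) (rising (suc a) m) (a !)) (cong ((suc m + suc a) *_) (rising-! a m))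

ratio≡rising : ∀ a m → ratio (suc m) (suc a) ≡ rising (suc a) m
ratio≡rising a m = trans (cong (λ z → _/_ z (a !) {{a !≢0}}) (sym (rising-! a m)))
  (m*n/n≡m (rising (suc a) m) (a !) {{a !≢0}})

-- The factor (m + a) ^ a stands for the choices of row 0; the factors 2 ^ a of the other rows
-- collect into the scale.
min-weight≡rising : ∀ a m → (m + a) ^ a * min-weight a m ≡ (2 ^ a) ^ m * rising a m ^ a
min-weight≡rising a zero = *-comm (a ^ a) 1
min-weight≡rising a (suc m) = begin
  (suc m + a) ^ a * ((2 * (m + a)) ^ a * min-weight a m)
    ≡⟨ cong (λ z → (suc m + a) ^ a * (z * min-weight a m)) (^-distribʳ-* 2 (m + a) a) ⟩
  (suc m + a) ^ a * (2 ^ a * (m + a) ^ a * min-weight a m)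
    ≡⟨ id₁ ((suc m + a) ^ a) (2 ^ a) ((m + a) ^ a) (min-weight a m) ⟩
  2 ^ a * (suc m + a) ^ a * ((m + a) ^ a * min-weight a m)
    ≡⟨ cong (2 ^ a * (suc m + a) ^ a *_) (min-weight≡rising a m) ⟩
  2 ^ a * (suc m + a) ^ a * ((2 ^ a) ^ m * rising a m ^ a)
    ≡⟨ id₂ (2 ^ a) ((suc m + a) ^ a) ((2 ^ a) ^ m) (rising a m ^ a) ⟩
  2 ^ a * (2 ^ a) ^ m * ((suc m + a) ^ a * rising a m ^ a)
    ≡⟨ cong (2 ^ a * (2 ^ a) ^ m *_) (^-distribʳ-* (suc m + a) (rising a m) a) ⟨
  (2 ^ a) ^ suc m * rising a (suc m) ^ a                        ∎
  where
  open ≡-Reasoning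
  id₁ : ∀ p t q z → p * (t * q * z) ≡ t * p * (q * z)
  id₁ = solve-∀
  id₂ : ∀ t p q z → t * p * (q * z) ≡ t * q * (p * z)
  id₂ = solve-∀

module _ .{{_ : NonZero a}} (A : Fin (suc m) → Fin a → List ℕ) (uA : ∀ v i → Unique (A v i))
         (longA : ∀ v i → m + a ≤ length (A v i)) (disj : ∀ v → Disjointed (A v)) where

  colourings-unique : Unique (colourings A)
  colourings-unique = branch-unique (choices-unique (uA zero)) (λ r → extensions-unique r (A ∘ suc) (uA ∘ suc))

  colourings-proper : ∀ {c} → c ∈ colourings A → ProperRows A c
  colourings-proper {r ∷ c} c∈ with r∈ , c∈′ ← ∈-branch⁻ (choices (A zero)) c∈ =
    proper-∷ (∈-choices⁻ (A zero) r∈) (extensions-proper r (A ∘ suc) c∈′)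

  colourings-weight : (2 ^ a) ^ m * rising a m ^ a ≤ ∑ weight (colourings A)
  colourings-weight = begin
    (2 ^ a) ^ m * rising a m ^ a          ≡⟨ min-weight≡rising a m ⟨
    (m + a) ^ a * min-weight a m               ≡⟨ cong (_* min-weight a m) (∏-const {a} (m + a)) ⟨
    ∏ {a} (λ _ → m + a) * min-weight a m       ≤⟨ *-monoˡ-≤ (min-weight a m) (∏-mono (longA zero)) ⟩
    ∏ (length ∘ A zero) * min-weight a m
      ≡⟨ cong (_* min-weight a m) (trans (sym (length≡∑ rows)) (length-choices (A zero))) ⟨
    ∑ (λ _ → 1) rows * min-weight a m          ≡⟨ ∑-*ʳ (min-weight a m) (λ _ → 1) rows ⟨
    ∑ (λ _ → 1 * min-weight a m) rows          ≤⟨ ∑-mono rows (λ r → ≤-trans (≤-reflexive (*-identityˡ _))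
                                               (extensions-weight r (A ∘ suc) (uA ∘ suc) (longA ∘ suc) (λ v → disj (suc v)))) ⟩
    ∑ (λ r → ∑ (λ c → weight (r ∷ c)) (extensions r (A ∘ suc))) rows ≡⟨ ∑-branch weight rows _ ⟨
    ∑ weight (colourings A)               ∎
    where
    open ≤-Reasoning
    rows = choices (A zero)

  -- Each right copy defeats scaled weight at most `W`, while the total is at least `W` times the
  -- threshold and hence exceeds `b * W`.
  unobstructed-colouring : ∀ {b} (S : Fin b → Fin (suc m) → List ℕ) →
    (∀ j v → Unique (S j v)) → (∀ j v → length (S j v) ≡ m + a) → b < rising a m ^ a →
    ∃ λ c → ProperRows A c × (∀ j → ¬ Obstruction (residual (S j) c))
  unobstructed-colouring {b} S uS lenS b< =
    let c , c∈ , good = avoid-all (λ j c → obstruction? (residual (S j) c)) weight W (colourings A) colourings-unique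
          (λ j ys uy sub → obstructed-weight disj (uS j) (lenS j) ys uy λ y∈ → colourings-proper (proj₁ (sub y∈)) , proj₂ (sub y∈))
          (begin-strict
            b * W                 <⟨ *-monoˡ-< W b< ⟩
            rising a m ^ a * W    ≡⟨ *-comm (rising a m ^ a) W ⟩
            W * rising a m ^ a    ≤⟨ colourings-weight ⟩
            ∑ weight (colourings A) ∎)
    in c , colourings-proper c∈ , good
    where
    open ≤-Reasoning
    W = (2 ^ a) ^ m
    instance
      W≢0 : NonZero W
      W≢0 = m^n≢0 (2 ^ a) m {{m^n≢0 2 a}}

-- Choosability of the product graph

choosable-mono : ∀ {G k l} → k ≤ l → Choosable G k → Choosable G l
choosable-mono {G} {k} k≤l ch L isL =
  let f , f∈ , proper = ch (take k ∘ L) λ v →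
        trans (length-take k (L v)) (trans (cong (k ⊓_) (proj₁ (isL v))) (m≤n⇒m⊓n≡m k≤l)) ,
        Unique.take⁺ k (proj₂ (isL v))
  in f , (λ v → ∈-take (L v) k (f∈ v)) , proper
  where
  ∈-take : ∀ xs k {x : ℕ} → x ∈ take k xs → x ∈ xs
  ∈-take (y ∷ ys) (suc k) (here refl) = here refl
  ∈-take (y ∷ ys) (suc k) (there p) = there (∈-take ys k p)

module _ {m a b : ℕ} (L : V (K (suc m) □ KBip a b) → List ℕ) where

  -- Vertices of different right copies are never adjacent, so once the left side is coloured each
  -- right copy is an independent SDR problem.
  assemble : (g : Fin (suc m) → Fin a → ℕ) → (∀ v i → g v i ∈ L (v , inj₁ i)) →
    (∀ u v → u ≢ v → ∀ i → g u i ≢ g v i) →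
    (∀ j → SDR (λ v → L (v , inj₂ j) ∖ tabulate (g v))) → LColorable (K (suc m) □ KBip a b) L
  assemble g g∈ g-proper h = f , f∈ , proper
    where
    f : V (K (suc m) □ KBip a b) → ℕ
    f (v , inj₁ i) = g v i
    f (v , inj₂ j) = proj₁ (h j) v
    h-split : ∀ j v → proj₁ (h j) v ∈ L (v , inj₂ j) × proj₁ (h j) v ∉ tabulate (g v)
    h-split j v = ∈-∖⁻ {xs = L (v , inj₂ j)} (tabulate (g v)) (proj₁ (proj₂ (h j)) v)
    f∈ : ∀ p → f p ∈ L p
    f∈ (v , inj₁ i) = g∈ v i
    f∈ (v , inj₂ j) = proj₁ (h-split j v)
    proper : ∀ p q → Adj (K (suc m) □ KBip a b) p q → f p ≢ f q
    proper (v , inj₁ i) (.v , inj₂ j) (inj₁ (refl , _)) eq =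
      proj₂ (h-split j v) (subst (_∈ tabulate (g v)) eq (∈-tabulate⁺ i))
    proper (v , inj₂ j) (.v , inj₁ i) (inj₁ (refl , _)) eq =
      proj₂ (h-split j v) (subst (_∈ tabulate (g v)) (sym eq) (∈-tabulate⁺ i))
    proper (u , inj₁ i) (v , .(inj₁ i)) (inj₂ (refl , u≢v)) = g-proper u v u≢v i
    proper (u , inj₂ j) (v , .(inj₂ j)) (inj₂ (refl , u≢v)) = proj₂ (proj₂ (h j)) u v u≢v

  module _ {k : ℕ} (isL : IsAssignment (K (suc m) □ KBip a b) k L) where

    length-right : ∀ j v (g : Fin a → ℕ) → k ≤ length (L (v , inj₂ j) ∖ tabulate g) + a
    length-right j v g = subst₂ (λ l l′ → l ≤ length (L (v , inj₂ j) ∖ tabulate g) + l′)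
      (proj₁ (isL (v , inj₂ j))) (length-tabulate g) (length-∖ (tabulate g) (proj₂ (isL (v , inj₂ j))))

K□KBip-choosable : ∀ m a b → Choosable (K (suc m) □ KBip a b) (suc m + a)
K□KBip-choosable m a b L isL = assemble L (λ v i → proj₁ (left i) v) (λ v i → proj₁ (proj₂ (left i)) v)
  (λ u v u≢v i → proj₂ (proj₂ (left i)) u v u≢v)
  (λ j → greedy _ (λ v → ∖-unique _ (proj₂ (isL _))) (λ v → +-cancelʳ-≤ a _ _ (length-right L isL j v _)))
  where
  left : ∀ i → SDR (λ v → L (v , inj₁ i))
  left i = greedy _ (λ v → proj₂ (isL _)) (λ v → ≤-trans (m≤m+n (suc m) a) (≤-reflexive (sym (proj₁ (isL (v , inj₁ i))))))

few-right-copies⇒choosable : ∀ m a b → b < rising (suc a) m ^ suc a →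
  Choosable (K (suc m) □ KBip (suc a) b) (m + suc a)
few-right-copies⇒choosable m a b b< L isL
  with Fin.any? (λ v → Fin.any? λ i → Fin.any? λ i′ → ¬? (i Fin.≟ i′) ×-dec Any.any? (_∈? L (v , inj₁ i′)) (L (v , inj₁ i)))
... | no ¬common =
  let c , p , good = unobstructed-colouring (λ v i → L (v , inj₁ i)) (λ v i → proj₂ (isL _))
        (λ v i → ≤-reflexive (sym (proj₁ (isL _)))) disj (λ j v → L (v , inj₂ j)) (λ j v → proj₂ (isL _))
        (λ j v → proj₁ (isL _)) b<
  in assemble L (λ v → lookup (lookup c v)) (from-lists p) (rows-distinct p) λ j →
       unobstructed⇒SDR _ (λ v → ∖-unique _ (proj₂ (isL _)))
         (λ v → +-cancelʳ-≤ (suc a) _ _ (length-right L isL j v (lookup (lookup c v)))) (good j)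
  where
  open ProperRows
  disj : ∀ v → Disjointed (λ i → L (v , inj₁ i))
  disj v {i} {i′} p q = decidable-stable (i Fin.≟ i′) λ i≢i′ → ¬common (v , i , i′ , i≢i′ , lose p q)
-- Repeating `x` in row `w` leaves every right list at `w` one colour longer than required, as
-- `greedy-one-long` demands.
... | yes (w , i , i′ , i≢i′ , common) with x , x∈i , x∈i′ ← find common =
  assemble L g (λ v l → proj₁ (proj₂ (proj₁ (left l))) v) (λ u v u≢v l → proj₂ (proj₂ (proj₁ (left l))) u v u≢v) λ j →
    greedy-one-long _ (λ v → ∖-unique _ (proj₂ (isL _)))
      (λ v → +-cancelʳ-≤ (suc a) _ _ (length-right L isL j v (g v))) w
      (+-cancelʳ-≤ a _ _ (begin
        suc m + a                                          ≡⟨ +-suc m a ⟨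
        m + suc a                                          ≡⟨ proj₁ (isL (w , inj₂ j)) ⟨
        length (L (w , inj₂ j))
          ≤⟨ length-∖-repeat (g w) i≢i′ (trans (g≡x x∈i) (sym (g≡x x∈i′))) (proj₂ (isL (w , inj₂ j))) ⟩
        length (L (w , inj₂ j) ∖ tabulate (g w)) + a       ∎))
  where
  open ≤-Reasoning
  long : ∀ v l → suc m ≤ length (L (v , inj₁ l))
  long v l = ≤-trans (≤-trans (m≤m+n (suc m) a) (≤-reflexive (sym (+-suc m a)))) (≤-reflexive (sym (proj₁ (isL (v , inj₁ l)))))
  -- Every left copy that can use `x` at `w` does so, which covers `i` and `i′` with one definition.
  left : ∀ l → Σ (SDR (λ v → L (v , inj₁ l))) λ (f , _) → x ∈ L (w , inj₁ l) → f w ≡ x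
  left l with x ∈? L (w , inj₁ l)
  ... | yes x∈ = let s , eq = greedy-prescribed _ (λ v → proj₂ (isL _)) (λ v → long v l) w x∈ in s , λ _ → eq
  ... | no x∉ = greedy _ (λ v → proj₂ (isL _)) (λ v → long v l) , λ x∈ → contradiction x∈ x∉
  g : Fin (suc m) → Fin (suc a) → ℕ
  g v l = proj₁ (proj₁ (left l)) v
  g≡x : ∀ {l} → x ∈ L (w , inj₁ l) → g w l ≡ x
  g≡x {l} = proj₂ (left l)

-- An uncolourable assignment for many right copies

arrangements : List ℕ → (n : ℕ) → List (Vec ℕ n)
arrangements xs zero = [ [] ]
arrangements xs (suc n) = branch xs (λ x → arrangements (xs ∖ [ x ]) n)

∈-arrangements⁺ : ∀ {xs} {c : Vec ℕ n} → (∀ v → lookup c v ∈ xs) →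
  (∀ u v → u ≢ v → lookup c u ≢ lookup c v) → c ∈ arrangements xs n
∈-arrangements⁺ {c = []} c∈ distinct = here refl
∈-arrangements⁺ {c = x ∷ c} c∈ distinct = ∈-branch⁺ (c∈ zero) (∈-arrangements⁺
  (λ v → ∈-∖⁺ (c∈ (suc v)) λ { (here eq) → distinct (suc v) zero (λ ()) eq })
  (λ u v u≢v → distinct (suc u) (suc v) (u≢v ∘ Fin.suc-injective)))

∈-arrangements⁻ : ∀ xs {c : Vec ℕ n} → c ∈ arrangements xs n → ∀ v → lookup c v ∈ xs
∈-arrangements⁻ xs {x ∷ c} c∈ zero = proj₁ (∈-branch⁻ xs c∈)
∈-arrangements⁻ xs {x ∷ c} c∈ (suc v) =
  proj₁ (∈-∖⁻ [ x ] (∈-arrangements⁻ (xs ∖ [ x ]) (proj₂ (∈-branch⁻ xs c∈)) v))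

length-branch-≤ : ∀ (xs : List X) (f : X → List (Vec X n)) K → (∀ {x} → x ∈ xs → length (f x) ≤ K) →
  length (branch xs f) ≤ length xs * K
length-branch-≤ xs f K le = begin
  length (branch xs f)                ≡⟨ length≡∑ (branch xs f) ⟩
  ∑ (λ _ → 1) (branch xs f)           ≡⟨ ∑-branch (λ _ → 1) xs f ⟩
  ∑ (λ x → ∑ (λ _ → 1) (f x)) xs      ≡⟨ *-identityʳ _ ⟨
  ∑ (λ x → ∑ (λ _ → 1) (f x)) xs * 1  ≤⟨ ∑≤length* _ 1 K xs (λ {x} x∈ →
                                            ≤-trans (≤-reflexive (trans (*-identityʳ _) (sym (length≡∑ (f x))))) (le x∈)) ⟩
  length xs * K                       ∎
  where open ≤-Reasoning

-- Each chosen colour is struck from the list, which gives the factors m + a, ..., a in turn.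
length-arrangements : ∀ a m xs → length xs ≤ m + a → length (arrangements xs (suc m)) ≤ rising a m
length-arrangements a zero xs len = ≤-trans (length-branch-≤ xs _ 1 (λ _ → ≤-refl)) (≤-trans (≤-reflexive (*-identityʳ _)) len)
length-arrangements a (suc m) xs len = ≤-trans
  (length-branch-≤ xs _ (rising a m) λ {x} x∈ → length-arrangements a m (xs ∖ [ x ])
    (≤-pred (≤-trans (filter-notAll (_∉? [ x ]) xs (lose x∈ λ x∉ → x∉ (here refl))) len)))
  (*-monoˡ-≤ (rising a m) len)

module HardAssignment (m a b : ℕ) (b≥ : rising (suc a) m ^ suc a ≤ b) where

  G : Graph
  G = K (suc m) □ KBip (suc a) b

  k : ℕ
  k = m + suc a

  -- Colours come in blocks of size `k`: block `zero` supplies the reserve, and block `suc i` is the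
  -- list of left copy `i` at every vertex.
  colour : Fin (suc (suc a)) → Fin k → ℕ
  colour i y = toℕ (combine i y)

  colour-injective : ∀ i j {x y} → colour i x ≡ colour j y → i ≡ j × x ≡ y
  colour-injective i j {x} {y} eq = Fin.combine-injective i x j y (Fin.toℕ-injective eq)

  pool : Fin (suc a) → List ℕ
  pool i = tabulate (colour (suc i))

  pool-disjointed : Disjointed pool
  pool-disjointed {i} {j} p q with ∈-tabulate⁻ {f = colour (suc i)} p
  ... | _ , refl with ∈-tabulate⁻ {f = colour (suc j)} q
  ... | _ , eq = Fin.suc-injective (proj₁ (colour-injective (suc i) (suc j) eq))

  reserve : List ℕ
  reserve = tabulate (λ (y : Fin m) → colour zero (y ↑ˡ suc a))

  reserve-unique : Unique reserve
  reserve-unique = Unique.tabulate⁺ λ eq → Fin.↑ˡ-injective (suc a) _ _ (proj₂ (colour-injective zero zero eq))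

  pool-unique : ∀ i → Unique (pool i)
  pool-unique i = Unique.tabulate⁺ (proj₂ ∘ colour-injective (suc i) (suc i))

  pool∌reserve : ∀ {i x} → x ∈ pool i → x ∉ reserve
  pool∌reserve {i} p q with ∈-tabulate⁻ {f = colour (suc i)} p
  ... | _ , refl with ∈-tabulate⁻ {f = λ (y : Fin m) → colour zero (y ↑ˡ suc a)} q
  ... | _ , eq with () ← proj₁ (colour-injective (suc i) zero eq)

  copy-colourings : Fin (suc a) → List (Vec ℕ (suc m))
  copy-colourings i = arrangements (pool i) (suc m)

  -- The outer index is the left copy and the inner one the vertex, the transpose of `colourings`:
  -- here the left copies are coloured independently.
  left-colourings : List (Vec (Vec ℕ (suc m)) (suc a))
  left-colourings = choices copy-colourings

  length-left-colourings : length left-colourings ≤ b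
  length-left-colourings = begin
    length left-colourings                                    ≡⟨ length-choices copy-colourings ⟩
    ∏ (length ∘ copy-colourings)
      ≤⟨ ∏-mono {suc a} (λ i → length-arrangements (suc a) m (pool i) (≤-reflexive (length-tabulate (colour (suc i))))) ⟩
    ∏ {suc a} (λ _ → rising (suc a) m)                        ≡⟨ ∏-const {suc a} (rising (suc a) m) ⟩
    rising (suc a) m ^ suc a                                  ≤⟨ b≥ ⟩
    b                                                         ∎
    where open ≤-Reasoning

  spoiler : Vec (Vec ℕ (suc m)) (suc a) → Fin (suc m) → List ℕ
  spoiler c v = tabulate (λ i → lookup (lookup c i) v) ++ reserve

  spoiler-valid : ∀ {c} → c ∈ left-colourings → ∀ v → length (spoiler c v) ≡ k × Unique (spoiler c v)
  spoiler-valid {c} c∈ v =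
    trans (length-++ row) (trans
      (cong₂ _+_ (length-tabulate entry) (length-tabulate (λ (y : Fin m) → colour zero (y ↑ˡ suc a))))
      (+-comm (suc a) m)) ,
    Unique.++⁺ (Unique.tabulate⁺ λ {i} {j} eq → pool-disjointed {i} {j} (entry∈ i) (subst (_∈ pool j) (sym eq) (entry∈ j)))
      reserve-unique λ (p , q) → row∌reserve p q
    where
    entry : Fin (suc a) → ℕ
    entry i = lookup (lookup c i) v
    row = tabulate entry
    entry∈ : ∀ i → entry i ∈ pool i
    entry∈ i = ∈-arrangements⁻ (pool i) (∈-choices⁻ copy-colourings c∈ i) v
    row∌reserve : ∀ {x} → x ∈ row → x ∉ reserve
    row∌reserve p with i , refl ← ∈-tabulate⁻ {f = entry} p = pool∌reserve {i} (entry∈ i)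

  right-list : ℕ → Fin (suc m) → List ℕ
  right-list j v with j <? length left-colourings
  ... | yes j< = spoiler (List.lookup left-colourings (fromℕ< j<)) v
  -- Surplus right copies receive an arbitrary valid list.
  ... | no _ = pool zero

  right-list-valid : ∀ j v → length (right-list j v) ≡ k × Unique (right-list j v)
  right-list-valid j v with j <? length left-colourings
  ... | yes j< = spoiler-valid (∈-lookup (fromℕ< j<)) v
  ... | no _ = length-tabulate (colour (suc zero)) , pool-unique zero

  right-list-index : ∀ l v → right-list (toℕ l) v ≡ spoiler (List.lookup left-colourings l) v
  right-list-index l v with toℕ l <? length left-colourings
  ... | yes l< = cong (λ z → spoiler (List.lookup left-colourings z) v) (Fin.fromℕ<-toℕ l l<)
  ... | no l≮ = contradiction (Fin.toℕ<n l) l≮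

  assignment : V G → List ℕ
  assignment (v , inj₁ i) = pool i
  assignment (v , inj₂ j) = right-list (toℕ j) v

  assignment-valid : IsAssignment G k assignment
  assignment-valid (v , inj₁ i) = length-tabulate (colour (suc i)) , pool-unique i
  assignment-valid (v , inj₂ j) = right-list-valid (toℕ j) v

  uncolourable : ¬ LColorable G assignment
  -- Pigeonhole: `m + 1` pairwise adjacent vertices would all take their colours from the `m`
  -- reserve colours.
  uncolourable (f , f∈ , proper) = <⇒≱ (n<1+n m) (begin
    suc m                    ≡⟨ length-tabulate {n = suc m} id ⟨
    length (allFin (suc m))
      ≤⟨ injection⇒length≤ right (Unique.allFin⁺ (suc m)) (λ _ _ → right-injective) (λ {v} _ → right∈reserve v) ⟩
    length reserve           ≡⟨ length-tabulate (λ (y : Fin m) → colour zero (y ↑ˡ suc a)) ⟩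
    m                        ∎)
    where
    open ≤-Reasoning
    c : Vec (Vec ℕ (suc m)) (suc a)
    c = Vec.tabulate (λ i → Vec.tabulate (λ v → f (v , inj₁ i)))
    entry : ∀ i v → lookup (lookup c i) v ≡ f (v , inj₁ i)
    entry i v = trans
      (cong (λ r → lookup r v) (Vec.lookup∘tabulate (λ i → Vec.tabulate (λ v → f (v , inj₁ i))) i))
      (Vec.lookup∘tabulate (λ v → f (v , inj₁ i)) v)
    c∈ : c ∈ left-colourings
    c∈ = ∈-choices⁺ copy-colourings λ i → ∈-arrangements⁺
      (λ v → subst (_∈ pool i) (sym (entry i v)) (f∈ (v , inj₁ i)))
      (λ u v u≢v eq → proper (u , inj₁ i) (v , inj₁ i) (inj₂ (refl , u≢v)) (trans (sym (entry i u)) (trans eq (entry i v))))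
    j : Fin b
    -- The right copy whose lists were built to defeat this left colouring.
    j = inject≤ (Any.index c∈) length-left-colourings
    right : Fin (suc m) → ℕ
    right v = f (v , inj₂ j)
    right-injective : ∀ {u v} → right u ≡ right v → u ≡ v
    right-injective {u} {v} eq = decidable-stable (u Fin.≟ v) λ u≢v → proper (u , inj₂ j) (v , inj₂ j) (inj₂ (refl , u≢v)) eq
    right-list≡ : ∀ v → assignment (v , inj₂ j) ≡ spoiler c v
    right-list≡ v = trans (cong (λ t → right-list t v) (Fin.toℕ-inject≤ (Any.index c∈) length-left-colourings))
      (trans (right-list-index (Any.index c∈) v) (cong (λ z → spoiler z v) (sym (lookup-index c∈))))
    right∈reserve : ∀ v → right v ∈ reserve
    right∈reserve v with ∈-++⁻ (tabulate λ i → lookup (lookup c i) v) (subst (right v ∈_) (right-list≡ v) (f∈ (v , inj₂ j)))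
    ... | inj₂ p = p
    ... | inj₁ p with i , eq ← ∈-tabulate⁻ {f = λ i → lookup (lookup c i) v} p =
      contradiction (trans (sym (entry i v)) (sym eq)) (proper (v , inj₁ i) (v , inj₂ j) (inj₁ (refl , tt)))

many-right-copies⇒¬choosable : ∀ m a b → rising (suc a) m ^ suc a ≤ b →
  ¬ Choosable (K (suc m) □ KBip (suc a) b) (m + suc a)
many-right-copies⇒¬choosable m a b b≥ ch = uncolourable (ch assignment assignment-valid)
  where open HardAssignment m a b b≥

theorem8 : (n a b : ℕ) → 1 ≤ n → 1 ≤ a → 1 ≤ b →
    (ListChromaticNumber (K n □ KBip a b) (n + a) → b ≥ ratio n a ^ a)
    × (b ≥ ratio n a ^ a → ListChromaticNumber (K n □ KBip a b) (n + a))
theorem8 (suc m) (suc a) b _ _ _ rewrite ratio≡rising a m = enough , exact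
  where
  enough : ListChromaticNumber (K (suc m) □ KBip (suc a) b) (suc m + suc a) → b ≥ rising (suc a) m ^ suc a
  enough (_ , least) = ≮⇒≥ λ b< →
    <⇒≱ (n<1+n (m + suc a)) (least (m + suc a) (few-right-copies⇒choosable m a b b<))
  exact : b ≥ rising (suc a) m ^ suc a → ListChromaticNumber (K (suc m) □ KBip (suc a) b) (suc m + suc a)
  -- A `k` below n + a is at most n + a - 1, so by monotonicity only that value has to be refuted.
  exact b≥ = K□KBip-choosable m (suc a) b , λ k ch → ≮⇒≥ λ k< →
    many-right-copies⇒¬choosable m a b b≥ (choosable-mono {K (suc m) □ KBip (suc a) b} (≤-pred k<) ch)
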